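{- Let $\mathrm{DS} = \{\langle e,x,u\rangle : (\forall y)[L^e_x \neq L^e_y \rightarrow L^e_x \cap D_u \neq L^e_y \cap D_u]\}$ and let $\mathrm{MDS} = \{\langle e,x,u\rangle \in \mathrm{DS} : (\forall u')[\,|D_{u'}| < |D_u| \rightarrow \langle e,x,u'\rangle \notin \mathrm{DS}]\}$. Then $\mathrm{MDS}$ is $\Pi^0_3$-complete.
   Context: $W_0,W_1,\ldots$ is an acceptable numbering of all r.e. subsets of $\mathbb N$, and $\langle\cdot,\cdot\rangle$ (and its iterates for tuples) is a standard recursive pairing function. For all $e,j$, $L^e_j = \{x : \langle j,x\rangle \in W_e\}$ and $\mathcal L_e = \{L^e_j : j\in\mathbb N\}$. $D_0,D_1,\ldots$ is the canonical numbering of finite sets: $D_0=\emptyset$ and $D_{2^{x_1}+\cdots+2^{x_n}} = \{x_1,\ldots,x_n\}$ for pairwise distinct $x_i$. $\Pi^0_n$-complete means definable by a $\Pi^0_n$ formula and every $\Pi^0_n$ set many-one reduces to it via a recursive function. -}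

module Defs where

open import Data.Nat using (ℕ; zero; suc; _+_; _*_; _<_)
open import Data.Nat.DivMod using (_/_; _%_)
open import Data.Bool using (Bool; true; false)
open import Data.Maybe using (Maybe; just; nothing; _>>=_)
open import Data.List using (List; length; filter; upTo)
open import Data.Product using (Σ; ∃; _×_; _,_; proj₁; proj₂)
open import Relation.Nullary using (¬_)
open import Relation.Binary.PropositionalEquality using (_≡_)
open import Function.Bundles using (_⇔_)
import Data.Nat.Properties as NP

tri : ℕ → ℕ
tri zero    = zero
tri (suc n) = suc n + tri n

pair : ℕ → ℕ → ℕ
pair x y = tri (x + y) + y

-- unpair enumerates (0,0),(1,0),(0,1),(2,0),(1,1),(0,2),... i.e. the
-- inverse of ⟨_,_⟩.
unpair : ℕ → ℕ × ℕ
unpair zero = (0 , 0)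
unpair (suc n) with unpair n
... | (zero  , b) = (suc b , 0)
... | (suc a , b) = (a , suc b)

π₁ π₂ : ℕ → ℕ
π₁ n = proj₁ (unpair n)
π₂ n = proj₂ (unpair n)

triple : ℕ → ℕ → ℕ → ℕ
triple e x u = pair e (pair x u)

-- Partial recursive functions (unary, on ℕ, tuples coded by pairing)

data Code : Set where
  Z S I L R : Code                 -- 0, successor, identity, π₁, π₂
  P         : Code → Code → Code   -- x ↦ ⟨f x , g x⟩
  C         : Code → Code → Code   -- x ↦ f (g x)
  Rec       : Code → Code → Code   -- ⟨y,0⟩ ↦ f y ; ⟨y,n+1⟩ ↦ g ⟨y,⟨n,h(y,n)⟩⟩
  Mu        : Code → Code          -- y ↦ least z with f⟨y,z⟩ = 0 (all earlier defined)

mutual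
  eval : ℕ → Code → ℕ → Maybe ℕ
  eval zero    _         _ = nothing
  eval (suc k) Z         x = just 0
  eval (suc k) S         x = just (suc x)
  eval (suc k) I         x = just x
  eval (suc k) L         x = just (π₁ x)
  eval (suc k) R         x = just (π₂ x)
  eval (suc k) (P f g)   x = eval k f x >>= λ a → eval k g x >>= λ b → just (pair a b)
  eval (suc k) (C f g)   x = eval k g x >>= λ a → eval k f a
  eval (suc k) (Rec f g) x = recLoop k f g (π₁ x) (π₂ x)
  eval (suc k) (Mu f)    x = muLoop k f x k 0

  recLoop : ℕ → Code → Code → ℕ → ℕ → Maybe ℕ
  recLoop k f g y zero    = eval k f y
  recLoop k f g y (suc n) = recLoop k f g y n >>= λ h → eval k g (pair y (pair n h))

  muLoop : ℕ → Code → ℕ → ℕ → ℕ → Maybe ℕ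
  muLoop k f x zero        z = nothing
  muLoop k f x (suc bound) z = eval k f (pair x z) >>= λ
    { zero    → just z
    ; (suc _) → muLoop k f x bound (suc z) }

-- Gödel numbering of codes: n = ⟨tag , payload⟩, payload = ⟨a , b⟩ for
-- the sub-codes; unknown tags decode to Z.  Fuel suc n suffices since
-- sub-code numbers of a composite node are strictly smaller.
decode : ℕ → ℕ → Code
decode zero    n = Z
decode (suc k) n with π₁ n
... | 0 = Z
... | 1 = S
... | 2 = I
... | 3 = L
... | 4 = R
... | 5 = P   (decode k (π₁ (π₂ n))) (decode k (π₂ (π₂ n)))
... | 6 = C   (decode k (π₁ (π₂ n))) (decode k (π₂ (π₂ n)))
... | 7 = Rec (decode k (π₁ (π₂ n))) (decode k (π₂ (π₂ n)))
... | 8 = Mu  (decode k (π₁ (π₂ n)))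
... | _ = Z

φ : ℕ → Code
φ e = decode (suc e) e

_⇓_ : ℕ → ℕ → ℕ → Set
(e ⇓ x) v = ∃ λ k → eval k (φ e) x ≡ just v

-- W_e = dom φ_e  (an acceptable numbering of the r.e. sets)
W : ℕ → ℕ → Set
W e x = ∃ λ v → (e ⇓ x) v

Lang : ℕ → ℕ → ℕ → Set
Lang e j x = W e (pair j x)

bit : ℕ → ℕ → ℕ
bit u zero    = u % 2
bit u (suc x) = bit (u / 2) x

_∈D_ : ℕ → ℕ → Set
x ∈D u = bit u x ≡ 1

-- |D_u|: all elements of D_u are < u (as 2^x ≤ u), so count them below u.
card : ℕ → ℕ
card u = length (filter (λ x → bit u x NP.≟ 1) (upTo u))

SameSet : (ℕ → Set) → (ℕ → Set) → Set
SameSet A B = ∀ z → A z ⇔ B z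

_∩D_ : (ℕ → Set) → ℕ → (ℕ → Set)
(A ∩D u) z = A z × z ∈D u

DS₃ : ℕ → ℕ → ℕ → Set
DS₃ e x u = ∀ y → ¬ SameSet (Lang e x) (Lang e y)
                → ¬ SameSet (Lang e x ∩D u) (Lang e y ∩D u)

MDS₃ : ℕ → ℕ → ℕ → Set
MDS₃ e x u = DS₃ e x u × (∀ u′ → card u′ < card u → ¬ DS₃ e x u′)

DS : ℕ → Set
DS n = Σ ℕ λ e → Σ ℕ λ x → Σ ℕ λ u → n ≡ triple e x u × DS₃ e x u

MDS : ℕ → Set
MDS n = Σ ℕ λ e → Σ ℕ λ x → Σ ℕ λ u → n ≡ triple e x u × MDS₃ e x u

Recursive : (ℕ → ℕ) → Set
Recursive f = Σ ℕ λ e → ∀ n → (e ⇓ n) (f n)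

Π⁰₃ : (ℕ → Set) → Set
Π⁰₃ A = Σ (ℕ → ℕ) λ χ → Recursive χ ×
          (∀ n → A n ⇔ (∀ a → ∃ λ b → ∀ c → χ (pair n (pair a (pair b c))) ≡ 0))

_≤m_ : (ℕ → Set) → (ℕ → Set) → Set
B ≤m A = Σ (ℕ → ℕ) λ f → Recursive f × (∀ n → B n ⇔ A (f n))

Π⁰₃-complete : (ℕ → Set) → Set₁
Π⁰₃-complete A = Π⁰₃ A × (∀ (B : ℕ → Set) → Π⁰₃ B → B ≤m A)

{-# OPTIONS --safe #-}
module Submission where

-- Membership.  Let Lₜ be the t-step approximation of L.  The set D_u fails to
-- single out L_x iff there are y, z, s such that at every stage t ≥ s the
-- approximations of L_x and L_y agree on D_u and disagree at z.  Hence DS is Π⁰₂,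
-- "no smaller u′ works" is a universally quantified Σ⁰₂ condition, and MDS is Π⁰₃.
-- The approximations are computed by an abstract machine with a recursive step.
--
-- Hardness.  For B = {n : ∀a ∃b ∀c χ⟨n,a,b,c⟩ = 0} build a family containing ℕ, {0},
-- {1} and, for all a and b, a language equal to {a+2} if ∀c χ⟨n,a,b,c⟩ = 0 and to ℕ
-- otherwise.  D₃ = {0,1} always distinguishes ℕ from the other members; ∅, {0}
-- and {1} never do, and {a+2} fails to do so iff ∃b ∀c χ⟨n,a,b,c⟩ = 0.

open import Defs
open import Level using (0ℓ)
open import Axiom.ExcludedMiddle using (ExcludedMiddle)
open import Data.Empty using (⊥; ⊥-elim)
open import Data.Fin using (Fin; zero; suc; #_)
open import Data.List using (List; []; _∷_; [_]; _++_; filter; length; upTo)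
open import Data.List.Properties using (filter-++; filter-accept; filter-reject; length-++; upTo-∷ʳ)
open import Data.Maybe using (Maybe; just; _>>=_)
open import Data.Maybe.Properties using (just-injective)
open import Data.Nat
open import Data.Nat.DivMod using (m%n<n; m*n%n≡0; m*n/n≡m; m/n<m; m/n≡1+[m∸n]/n)
open import Data.Nat.Properties
open import Data.Product using (∃; _×_; _,_; proj₁; proj₂)
open import Data.Sum using (_⊎_; inj₁; inj₂) renaming (map to ⊎-map)
open import Data.Unit using (⊤; tt)
open import Data.Vec using (Vec; []; _∷_; lookup)
open import Function using (_∘_)
open import Function.Bundles using (_⇔_; mk⇔; Equivalence)
open import Function.Properties.Equivalence using () renaming (sym to ⇔-sym; trans to ⇔-trans)
open import Relation.Binary.PropositionalEquality hiding ([_])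
open import Relation.Nullary using (¬_; Dec; yes; no; decidable-stable)
open Equivalence using (to; from)

-- A matrix has to be recursive, so "x is enumerated within t steps" must itself be computed by a
-- `Code`, uniformly in the Gödel number. The definition of `eval` does not translate directly: it
-- recurses on fuel, on the code and through two inner loops at once. A stack machine flattens this.
-- One step is a mere case distinction, and the state after t steps is a primitive recursion. Its
-- step count need not match the fuel of `eval`, because only limits of stages matter.
--
-- Agreement of two languages on a finite set and disagreement at one point are both decided in the
-- limit, so one stage s serves for both. This keeps the failure of DS at the level Σ⁰₂, although
-- equality of two r.e. languages is itself Π⁰₂.
--
-- In the hardness proof the three quantifiers turn into a point, an index and a search: a chooses
-- the singleton, b is part of the index of a language, and c is looked for by the enumeration. A
-- wrong b does no harm, since its language grows to ℕ, and DS demands nothing of languages equal to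
-- L_x. A right b leaves a true singleton behind.

-- The pairing function and its inverse

pair-suc : ∀ x y → pair x (suc y) ≡ suc (pair (suc x) y)
pair-suc x y rewrite +-suc x y = +-suc (tri (suc (x + y))) y

pair-zero : ∀ x → pair (suc x) 0 ≡ suc (pair 0 x)
pair-zero x rewrite +-identityʳ x | +-identityʳ (x + tri x) = cong suc (+-comm x (tri x))

unpair-pair : ∀ x y → unpair (pair x y) ≡ (x , y)
unpair-pair x y = go (x + y) y x refl
  where
  step₀ : ∀ n {b} → unpair n ≡ (0 , b) → unpair (suc n) ≡ (suc b , 0)
  step₀ n eq rewrite eq = refl

  step₊ : ∀ n {a b} → unpair n ≡ (suc a , b) → unpair (suc n) ≡ (a , suc b)
  step₊ n eq rewrite eq = refl

  go : ∀ s y x → x + y ≡ s → unpair (pair x y) ≡ (x , y)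
  go s (suc y) x eq = trans (cong unpair (pair-suc x y))
    (step₊ (pair (suc x) y) (go s y (suc x) (trans (sym (+-suc x y)) eq)))
  go s zero zero eq = refl
  go (suc s) zero (suc x) eq = trans (cong unpair (pair-zero x))
    (step₀ (pair 0 x) (go s x 0 (trans (sym (+-identityʳ x)) (suc-injective eq))))

π₁-pair : ∀ x y → π₁ (pair x y) ≡ x
π₁-pair x y = cong proj₁ (unpair-pair x y)

π₂-pair : ∀ x y → π₂ (pair x y) ≡ y
π₂-pair x y = cong proj₂ (unpair-pair x y)

pair-unpair : ∀ n → pair (π₁ n) (π₂ n) ≡ n
pair-unpair zero = refl
pair-unpair (suc n) with unpair n | pair-unpair n
... | (zero  , b) | ih = trans (pair-zero b) (cong suc ih)
... | (suc a , b) | ih = trans (pair-suc a b) (cong suc ih)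

m≤tri[m] : ∀ m → m ≤ tri m
m≤tri[m] zero    = z≤n
m≤tri[m] (suc m) = m≤m+n (suc m) (tri m)

m+n≤pair : ∀ m n → m + n ≤ pair m n
m+n≤pair m n = ≤-trans (m≤tri[m] (m + n)) (m≤m+n _ n)

π₁n≤n : ∀ n → π₁ n ≤ n
π₁n≤n n = ≤-trans (m≤m+n _ _) (≤-trans (m+n≤pair (π₁ n) (π₂ n)) (≤-reflexive (pair-unpair n)))

π₂n≤n : ∀ n → π₂ n ≤ n
π₂n≤n n = ≤-trans (m≤n+m _ (π₁ n)) (≤-trans (m+n≤pair (π₁ n) (π₂ n)) (≤-reflexive (pair-unpair n)))

π₁>0⇒π₂n<n : ∀ n → 0 < π₁ n → π₂ n < n
π₁>0⇒π₂n<n n p = ≤-trans (+-monoˡ-≤ (π₂ n) p)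
                   (≤-trans (m+n≤pair (π₁ n) (π₂ n)) (≤-reflexive (pair-unpair n)))

-- Evaluation of codes as an inductive relation

mutual
  -- Derivations carry no fuel, so one can do induction on a computation. The rules for `Rec` take
  -- any input `x` with an equation on `π₂ x`: an input index of the form `pair y n` is no
  -- constructor form and would block unification.
  data Ev : Code → ℕ → ℕ → Set where
    evZ    : ∀ {x} → Ev Z x 0
    evS    : ∀ {x} → Ev S x (suc x)
    evI    : ∀ {x} → Ev I x x
    evL    : ∀ {x} → Ev L x (π₁ x)
    evR    : ∀ {x} → Ev R x (π₂ x)
    evP    : ∀ {f g x a b} → Ev f x a → Ev g x b → Ev (P f g) x (pair a b)
    evC    : ∀ {f g x a b} → Ev g x a → Ev f a b → Ev (C f g) x b
    evRec0 : ∀ {f g x v} → π₂ x ≡ 0 → Ev f (π₁ x) v → Ev (Rec f g) x v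
    evRecS : ∀ {f g x n h v} → π₂ x ≡ suc n → Ev (Rec f g) (pair (π₁ x) n) h →
             Ev g (pair (π₁ x) (pair n h)) v → Ev (Rec f g) x v
    evMu   : ∀ {f x v} → Search f (pair x 0) v → Ev (Mu f) x v

  -- Search f ⟨x,z⟩ v: the search of Mu f on x, resumed at z, ends with v.
  data Search : Code → ℕ → ℕ → Set where
    found : ∀ {f w} → Ev f w 0 → Search f w (π₂ w)
    next  : ∀ {f w n v} → Ev f w (suc n) → Search f (pair (π₁ w) (suc (π₂ w))) v →
            Search f w v

ev-rec-zero : ∀ {f g y v} → Ev f y v → Ev (Rec f g) (pair y 0) v
ev-rec-zero {y = y} d = evRec0 (π₂-pair y 0) (subst (λ z → Ev _ z _) (sym (π₁-pair y 0)) d)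

ev-rec-suc : ∀ {f g y n h v} → Ev (Rec f g) (pair y n) h → Ev g (pair y (pair n h)) v →
             Ev (Rec f g) (pair y (suc n)) v
ev-rec-suc {f} {g} {y} {n} {h} {v} d d′ = evRecS (π₂-pair y (suc n))
  (subst (λ z → Ev (Rec f g) (pair z n) h) (sym (π₁-pair y (suc n))) d)
  (subst (λ z → Ev g (pair z (pair n h)) v) (sym (π₁-pair y (suc n))) d′)

>>=-just : ∀ {A B : Set} (m : Maybe A) {f : A → Maybe B} {v} →
           (m >>= f) ≡ just v → ∃ λ a → m ≡ just a × f a ≡ just v
>>=-just (just a) eq = a , refl , eq

mutual
  eval-sound : ∀ k c x {v} → eval k c x ≡ just v → Ev c x v
  eval-sound (suc k) Z x refl = evZ
  eval-sound (suc k) S x refl = evS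
  eval-sound (suc k) I x refl = evI
  eval-sound (suc k) L x refl = evL
  eval-sound (suc k) R x refl = evR
  eval-sound (suc k) (P f g) x eq with >>=-just (eval k f x) eq
  ... | a , p , eq′ with >>=-just (eval k g x) eq′
  ... | b , q , refl = evP (eval-sound k f x p) (eval-sound k g x q)
  eval-sound (suc k) (C f g) x eq with >>=-just (eval k g x) eq
  ... | a , p , q = evC (eval-sound k g x p) (eval-sound k f a q)
  eval-sound (suc k) (Rec f g) x eq =
    subst (λ z → Ev _ z _) (pair-unpair x) (recLoop-sound k f g (π₁ x) (π₂ x) eq)
  eval-sound (suc k) (Mu f) x eq = evMu (muLoop-sound k f x k 0 eq)

  recLoop-sound : ∀ k f g y n {v} → recLoop k f g y n ≡ just v → Ev (Rec f g) (pair y n) v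
  recLoop-sound k f g y zero    eq = ev-rec-zero (eval-sound k f y eq)
  recLoop-sound k f g y (suc n) eq with >>=-just (recLoop k f g y n) eq
  ... | h , p , q = ev-rec-suc {f} {g} {y} {n} (recLoop-sound k f g y n p) (eval-sound k g _ q)

  muLoop-sound : ∀ k f x j z {v} → muLoop k f x j z ≡ just v → Search f (pair x z) v
  muLoop-sound k f x (suc j) z {v} eq with >>=-just (eval k f (pair x z)) eq
  ... | zero  , p , refl =
    subst (Search f (pair x z)) (π₂-pair x z) (found (eval-sound k f _ p))
  ... | suc n , p , q = next (eval-sound k f (pair x z) p)
    (subst (λ w → Search f w v)
      (sym (cong₂ (λ a b → pair a (suc b)) (π₁-pair x z) (π₂-pair x z)))
      (muLoop-sound k f x j (suc z) q))

Eventually : (ℕ → Set) → Set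
Eventually Q = ∃ λ k → ∀ j → k ≤ j → Q j

eventually-suc : ∀ {Q : ℕ → Set} → Eventually (λ j → Q (suc j)) → Eventually Q
eventually-suc (k , h) = suc k , λ { (suc j) (s≤s le) → h j le }

eventually₂ : ∀ {Q Q′ Q″ : ℕ → Set} → Eventually Q → Eventually Q′ →
              (∀ j → Q j → Q′ j → Q″ j) → Eventually Q″
eventually₂ (k , h) (k′ , h′) f = k ⊔ k′ , λ j le →
  f j (h j (≤-trans (m≤m⊔n k k′) le)) (h′ j (≤-trans (m≤n⊔m k k′) le))

>>=-≡ : ∀ {A B : Set} {m : Maybe A} {f : A → Maybe B} {a v} →
        m ≡ just a → f a ≡ just v → (m >>= f) ≡ just v
>>=-≡ refl eq = eq

mutual
  eval-complete : ∀ {c x v} → Ev c x v → Eventually (λ k → eval k c x ≡ just v)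
  eval-complete evZ = 1 , λ { (suc j) _ → refl }
  eval-complete evS = 1 , λ { (suc j) _ → refl }
  eval-complete evI = 1 , λ { (suc j) _ → refl }
  eval-complete evL = 1 , λ { (suc j) _ → refl }
  eval-complete evR = 1 , λ { (suc j) _ → refl }
  eval-complete (evP d d′) = eventually-suc
    (eventually₂ (eval-complete d) (eval-complete d′) λ j p q → >>=-≡ p (>>=-≡ q refl))
  eval-complete (evC d d′) = eventually-suc
    (eventually₂ (eval-complete d) (eval-complete d′) λ j p q → >>=-≡ p q)
  eval-complete d@(evRec0 _ _)   = eventually-suc (recLoop-complete d)
  eval-complete d@(evRecS _ _ _) = eventually-suc (recLoop-complete d)
  eval-complete {x = x} (evMu d) with muLoop-complete d
  ... | k , h = eventually-suc (k , λ j le →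
    subst₂ (λ a b → muLoop j _ a j b ≡ _) (π₁-pair x 0) (π₂-pair x 0) (h j j le le))

  recLoop-complete : ∀ {f g x v} → Ev (Rec f g) x v →
                     Eventually (λ k → recLoop k f g (π₁ x) (π₂ x) ≡ just v)
  recLoop-complete (evRec0 eq d) rewrite eq = eval-complete d
  recLoop-complete {f} {g} {x} (evRecS {n = n} eq d d′) rewrite eq =
    eventually₂ (recLoop-complete d) (eval-complete d′) λ j p q → >>=-≡
      (subst₂ (λ a b → recLoop j f g a b ≡ _) (π₁-pair (π₁ x) n) (π₂-pair (π₁ x) n) p) q

  -- The fuel `j` and the bound `i` are separate because each round lowers the bound and leaves the
  -- fuel as it is.
  muLoop-complete : ∀ {f w v} → Search f w v →
    ∃ λ k → ∀ j i → k ≤ j → k ≤ i → muLoop j f (π₁ w) i (π₂ w) ≡ just v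
  muLoop-complete {f} {w} (found d) with eval-complete d
  ... | k , h = suc k , λ { j (suc i) le _ → >>=-≡
    (trans (cong (eval j f) (pair-unpair w)) (h j (≤-trans (n≤1+n k) le))) refl }
  muLoop-complete {f} {w} (next d d′) with eval-complete d | muLoop-complete d′
  ... | k , h | k′ , h′ = suc (k ⊔ k′) , λ { j (suc i) le (s≤s le′) → >>=-≡
    (trans (cong (eval j f) (pair-unpair w))
      (h j (≤-trans (≤-trans (m≤m⊔n k k′) (n≤1+n _)) le)))
    (subst₂ (λ a b → muLoop j f a i b ≡ _) (π₁-pair (π₁ w) (suc (π₂ w))) (π₂-pair (π₁ w) (suc (π₂ w)))
      (h′ j i (≤-trans (≤-trans (m≤n⊔m k k′) (n≤1+n _)) le) (≤-trans (m≤n⊔m k k′) le′))) }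

-- At a common large fuel both results are the value of the function `eval`.
Ev-functional : ∀ {c x v w} → Ev c x v → Ev c x w → v ≡ w
Ev-functional d d′ with eventually₂ (eval-complete d) (eval-complete d′)
                          (λ j p q → just-injective (trans (sym p) q))
... | k , h = h k ≤-refl

-- Gödel numbers of codes

lhs rhs : ℕ → ℕ
lhs n = π₁ (π₂ n)
rhs n = π₂ (π₂ n)

lhs< : ∀ n {t} → π₁ n ≡ suc t → lhs n < n
lhs< n eq = ≤-<-trans (π₁n≤n (π₂ n)) (π₁>0⇒π₂n<n n (subst (0 <_) (sym eq) z<s))

rhs< : ∀ n {t} → π₁ n ≡ suc t → rhs n < n
rhs< n eq = ≤-<-trans (π₂n≤n (π₂ n)) (π₁>0⇒π₂n<n n (subst (0 <_) (sym eq) z<s))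

-- A positive tag makes both halves smaller than `n`, so the fuel never runs out. The induction
-- hypotheses reach `go` under the condition of a positive tag, since for tag 0 that bound can fail,
-- as at `n = 0`.
decode-fuel : ∀ k k′ n → n < k → n < k′ → decode k n ≡ decode k′ n
decode-fuel (suc k) (suc k′) n (s≤s p) (s≤s p′) =
  go (λ {t} eq → decode-fuel k k′ _ (<-≤-trans (lhs< n {t} eq) p) (<-≤-trans (lhs< n {t} eq) p′))
     (λ {t} eq → decode-fuel k k′ _ (<-≤-trans (rhs< n {t} eq) p) (<-≤-trans (rhs< n {t} eq) p′))
  where
  go : (∀ {t} → π₁ n ≡ suc t → decode k (lhs n) ≡ decode k′ (lhs n)) →
       (∀ {t} → π₁ n ≡ suc t → decode k (rhs n) ≡ decode k′ (rhs n)) →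
       decode (suc k) n ≡ decode (suc k′) n
  go ihˡ ihʳ with π₁ n
  ... | 0 = refl
  ... | 1 = refl
  ... | 2 = refl
  ... | 3 = refl
  ... | 4 = refl
  ... | 5 = cong₂ P (ihˡ refl) (ihʳ refl)
  ... | 6 = cong₂ C (ihˡ refl) (ihʳ refl)
  ... | 7 = cong₂ Rec (ihˡ refl) (ihʳ refl)
  ... | 8 = cong Mu (ihˡ refl)
  ... | suc (suc (suc (suc (suc (suc (suc (suc (suc _)))))))) = refl

decode-lhs : ∀ n {t} → π₁ n ≡ suc t → decode n (lhs n) ≡ φ (lhs n)
decode-lhs n eq = decode-fuel n _ (lhs n) (lhs< n eq) ≤-refl

decode-rhs : ∀ n {t} → π₁ n ≡ suc t → decode n (rhs n) ≡ φ (rhs n)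
decode-rhs n eq = decode-fuel n _ (rhs n) (rhs< n eq) ≤-refl

φ-P : ∀ n → π₁ n ≡ 5 → φ n ≡ P (φ (lhs n)) (φ (rhs n))
φ-P n eq with decode-lhs n eq | decode-rhs n eq
... | p | q rewrite eq = cong₂ P p q

φ-C : ∀ n → π₁ n ≡ 6 → φ n ≡ C (φ (lhs n)) (φ (rhs n))
φ-C n eq with decode-lhs n eq | decode-rhs n eq
... | p | q rewrite eq = cong₂ C p q

φ-Rec : ∀ n → π₁ n ≡ 7 → φ n ≡ Rec (φ (lhs n)) (φ (rhs n))
φ-Rec n eq with decode-lhs n eq | decode-rhs n eq
... | p | q rewrite eq = cong₂ Rec p q

φ-Mu : ∀ n → π₁ n ≡ 8 → φ n ≡ Mu (φ (lhs n))
φ-Mu n eq with decode-lhs n eq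
... | p rewrite eq = cong Mu p

node : ℕ → ℕ → ℕ → ℕ
node t a b = pair t (pair a b)

lhs-node : ∀ t a b → lhs (node t a b) ≡ a
lhs-node t a b = trans (cong π₁ (π₂-pair t (pair a b))) (π₁-pair a b)

rhs-node : ∀ t a b → rhs (node t a b) ≡ b
rhs-node t a b = trans (cong π₂ (π₂-pair t (pair a b))) (π₂-pair a b)

⌜_⌝ : Code → ℕ
⌜ Z ⌝       = node 0 0 0
⌜ S ⌝       = node 1 0 0
⌜ I ⌝       = node 2 0 0
⌜ L ⌝       = node 3 0 0
⌜ R ⌝       = node 4 0 0
⌜ P f g ⌝   = node 5 ⌜ f ⌝ ⌜ g ⌝
⌜ C f g ⌝   = node 6 ⌜ f ⌝ ⌜ g ⌝
⌜ Rec f g ⌝ = node 7 ⌜ f ⌝ ⌜ g ⌝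
⌜ Mu f ⌝    = node 8 ⌜ f ⌝ 0

φ-⌜⌝ : ∀ c → φ ⌜ c ⌝ ≡ c
φ-⌜⌝ Z = refl
φ-⌜⌝ S = refl
φ-⌜⌝ I = refl
φ-⌜⌝ L = refl
φ-⌜⌝ R = refl
φ-⌜⌝ (P f g) = trans (φ-P ⌜ P f g ⌝ (π₁-pair 5 (pair ⌜ f ⌝ ⌜ g ⌝))) (cong₂ P
  (trans (cong φ (lhs-node 5 ⌜ f ⌝ ⌜ g ⌝)) (φ-⌜⌝ f))
  (trans (cong φ (rhs-node 5 ⌜ f ⌝ ⌜ g ⌝)) (φ-⌜⌝ g)))
φ-⌜⌝ (C f g) = trans (φ-C ⌜ C f g ⌝ (π₁-pair 6 (pair ⌜ f ⌝ ⌜ g ⌝))) (cong₂ C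
  (trans (cong φ (lhs-node 6 ⌜ f ⌝ ⌜ g ⌝)) (φ-⌜⌝ f))
  (trans (cong φ (rhs-node 6 ⌜ f ⌝ ⌜ g ⌝)) (φ-⌜⌝ g)))
φ-⌜⌝ (Rec f g) = trans (φ-Rec ⌜ Rec f g ⌝ (π₁-pair 7 (pair ⌜ f ⌝ ⌜ g ⌝))) (cong₂ Rec
  (trans (cong φ (lhs-node 7 ⌜ f ⌝ ⌜ g ⌝)) (φ-⌜⌝ f))
  (trans (cong φ (rhs-node 7 ⌜ f ⌝ ⌜ g ⌝)) (φ-⌜⌝ g)))
φ-⌜⌝ (Mu f) = trans (φ-Mu ⌜ Mu f ⌝ (π₁-pair 8 (pair ⌜ f ⌝ 0))) (cong Mu
  (trans (cong φ (lhs-node 8 ⌜ f ⌝ 0)) (φ-⌜⌝ f)))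

recursive : ∀ {f : ℕ → ℕ} c → (∀ n → Ev c n (f n)) → Recursive f
recursive {f} c h = ⌜ c ⌝ , λ n → let (k , p) = eval-complete (h n) in
  k , trans (cong (λ d → eval k d n) (φ-⌜⌝ c)) (p k ≤-refl)

-- A term language for recursive functions

-- Variables replace the routing of tuples through `L` and `R`. All terms are total. `ext` lets in a
-- function known only through an index, as is the matrix of an arbitrary Π⁰₃ set.
data Tm : ℕ → Set where
  var  : ∀ {n} → Fin n → Tm n
  lit  : ∀ {n} → ℕ → Tm n
  suc  : ∀ {n} → Tm n → Tm n
  pr   : ∀ {n} → Tm n → Tm n → Tm n
  fst  : ∀ {n} → Tm n → Tm n
  snd  : ∀ {n} → Tm n → Tm n
  ifz  : ∀ {n} → Tm n → Tm n → Tm n → Tm n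
  rec  : ∀ {n} → Tm n → Tm (2 + n) → Tm n → Tm n
  call : ∀ {n k} → Tm k → Vec (Tm n) k → Tm n
  ext  : ∀ {n} (f : ℕ → ℕ) → Recursive f → Tm n → Tm n

if-zero : ℕ → ℕ → ℕ → ℕ
if-zero zero    a b = a
if-zero (suc _) a b = b

natrec : ℕ → (ℕ → ℕ → ℕ) → ℕ → ℕ
natrec a g zero    = a
natrec a g (suc n) = g n (natrec a g n)

mutual
  ⟦_⟧ : ∀ {n} → Tm n → Vec ℕ n → ℕ
  ⟦ var i ⟧     ρ = lookup ρ i
  ⟦ lit k ⟧     ρ = k
  ⟦ suc t ⟧     ρ = suc (⟦ t ⟧ ρ)
  ⟦ pr s t ⟧    ρ = pair (⟦ s ⟧ ρ) (⟦ t ⟧ ρ)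
  ⟦ fst t ⟧     ρ = π₁ (⟦ t ⟧ ρ)
  ⟦ snd t ⟧     ρ = π₂ (⟦ t ⟧ ρ)
  ⟦ ifz c s t ⟧ ρ = if-zero (⟦ c ⟧ ρ) (⟦ s ⟧ ρ) (⟦ t ⟧ ρ)
  ⟦ rec a g c ⟧ ρ = natrec (⟦ a ⟧ ρ) (λ n h → ⟦ g ⟧ (n ∷ h ∷ ρ)) (⟦ c ⟧ ρ)
  ⟦ call t ts ⟧ ρ = ⟦ t ⟧ (⟦ ts ⟧* ρ)
  ⟦ ext f _ t ⟧ ρ = f (⟦ t ⟧ ρ)

  ⟦_⟧* : ∀ {n k} → Vec (Tm n) k → Vec ℕ n → Vec ℕ k
  ⟦ [] ⟧*     ρ = []
  ⟦ t ∷ ts ⟧* ρ = ⟦ t ⟧ ρ ∷ ⟦ ts ⟧* ρ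

enc : ∀ {n} → Vec ℕ n → ℕ
enc []      = 0
enc (x ∷ ρ) = pair x (enc ρ)

numeral : ℕ → Code
numeral zero    = Z
numeral (suc k) = C S (numeral k)

mutual
  compile : ∀ {n} → Tm n → Code
  compile (var zero)    = L
  compile (var (suc i)) = C (compile (var i)) R
  compile (lit k)       = numeral k
  compile (suc t)       = C S (compile t)
  compile (pr s t)      = P (compile s) (compile t)
  compile (fst t)       = C L (compile t)
  compile (snd t)       = C R (compile t)
  -- A case distinction is a primitive recursion that ignores its previous value; the environment is
  -- the parameter.
  compile (ifz c s t)   = C (Rec (compile s) (C (compile t) L)) (P I (compile c))
  compile (rec a g c)   =
    -- The inner code rearranges ⟨ρ,⟨n,h⟩⟩ into the environment ⟨n,⟨h,ρ⟩⟩ of `g`.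
    C (Rec (compile a) (C (compile g) (P (C L R) (P (C R R) L)))) (P I (compile c))
  compile (call t ts)   = C (compile t) (compile* ts)
  compile (ext _ r t)   = C (φ (proj₁ r)) (compile t)

  compile* : ∀ {n k} → Vec (Tm n) k → Code
  compile* []       = Z
  compile* (t ∷ ts) = P (compile t) (compile* ts)

numeral-correct : ∀ k {x} → Ev (numeral k) x k
numeral-correct zero    = evZ
numeral-correct (suc k) = evC (numeral-correct k) evS

evL-pair : ∀ a b → Ev L (pair a b) a
evL-pair a b = subst (Ev L (pair a b)) (π₁-pair a b) evL

evR-pair : ∀ a b → Ev R (pair a b) b
evR-pair a b = subst (Ev R (pair a b)) (π₂-pair a b) evR

mutual
  compile-correct : ∀ {n} (t : Tm n) ρ → Ev (compile t) (enc ρ) (⟦ t ⟧ ρ)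
  compile-correct (var zero)    (x ∷ ρ) = evL-pair x (enc ρ)
  compile-correct (var (suc i)) (x ∷ ρ) = evC (evR-pair x (enc ρ)) (compile-correct (var i) ρ)
  compile-correct (lit k)       ρ = numeral-correct k
  compile-correct (suc t)       ρ = evC (compile-correct t ρ) evS
  compile-correct (pr s t)      ρ = evP (compile-correct s ρ) (compile-correct t ρ)
  compile-correct (fst t)       ρ = evC (compile-correct t ρ) evL
  compile-correct (snd t)       ρ = evC (compile-correct t ρ) evR
  compile-correct (ifz c s t)   ρ = evC (evP evI (compile-correct c ρ)) (go (⟦ c ⟧ ρ))
    where
    go : ∀ k → Ev (Rec (compile s) (C (compile t) L)) (pair (enc ρ) k)
                  (if-zero k (⟦ s ⟧ ρ) (⟦ t ⟧ ρ))
    go zero    = ev-rec-zero {compile s} {C (compile t) L} {enc ρ} (compile-correct s ρ)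
    go (suc k) = ev-rec-suc {compile s} {C (compile t) L} {enc ρ} {k} (go k)
      (evC (evL-pair (enc ρ) (pair k _)) (compile-correct t ρ))
  compile-correct (rec a g c)   ρ = evC (evP evI (compile-correct c ρ)) (go (⟦ c ⟧ ρ))
    where
    g′ = C (compile g) (P (C L R) (P (C R R) L))
    val = natrec (⟦ a ⟧ ρ) (λ n h → ⟦ g ⟧ (n ∷ h ∷ ρ))
    go : ∀ k → Ev (Rec (compile a) g′) (pair (enc ρ) k) (val k)
    go zero    = ev-rec-zero {compile a} {g′} {enc ρ} (compile-correct a ρ)
    go (suc k) = ev-rec-suc {compile a} {g′} {enc ρ} {k} (go k)
      (evC (evP (evC (evR-pair y q) (evL-pair k h))
                (evP (evC (evR-pair y q) (evR-pair k h)) (evL-pair y q)))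
           (compile-correct g (k ∷ h ∷ ρ)))
      where
      y = enc ρ
      h = val k
      q = pair k h
  compile-correct (call t ts)   ρ = evC (compile*-correct ts ρ) (compile-correct t (⟦ ts ⟧* ρ))
  compile-correct (ext f (e , h) t) ρ =
    evC (compile-correct t ρ) (eval-sound (proj₁ (h x)) (φ e) x (proj₂ (h x)))
    where x = ⟦ t ⟧ ρ

  compile*-correct : ∀ {n k} (ts : Vec (Tm n) k) ρ → Ev (compile* ts) (enc ρ) (enc (⟦ ts ⟧* ρ))
  compile*-correct []       ρ = evZ
  compile*-correct (t ∷ ts) ρ = evP (compile-correct t ρ) (compile*-correct ts ρ)

compile₁ : Tm 1 → Code
compile₁ t = C (compile t) (P I Z)

compile₁-correct : ∀ t x → Ev (compile₁ t) x (⟦ t ⟧ (x ∷ []))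
compile₁-correct t x = evC (evP evI evZ) (compile-correct t (x ∷ []))

Tm-recursive : ∀ (t : Tm 1) {f} → (∀ x → ⟦ t ⟧ (x ∷ []) ≡ f x) → Recursive f
Tm-recursive t h = recursive (compile₁ t) λ x →
  subst (Ev (compile₁ t) x) (h x) (compile₁-correct t x)

-- A universal stack machine

predT : ∀ {n} → Tm n → Tm n
predT t = rec (lit 0) (var (# 0)) t

-- switch t (a₀ ∷ … ∷ aₖ₋₁ ∷ []) d is aₜ when t < k, and d otherwise.
switch : ∀ {n} → Tm n → List (Tm n) → Tm n → Tm n
switch t []       d = d
switch t (a ∷ as) d = ifz t a (switch (predT t) as d)

quadT : ∀ {n} → Tm n → Tm n → Tm n → Tm n → Tm n
quadT a b c d = pr a (pr b (pr c d))

unquadT : ∀ {n} → Tm n → Vec (Tm n) 4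
unquadT s = fst s ∷ fst (snd s) ∷ fst (snd (snd s)) ∷ snd (snd (snd s)) ∷ []

-- A machine state is 0 (halted), quad 1 m x K (evaluate program m on x) or
-- quad 2 v 0 K (return v); the stack K is 0 or quad tag d₁ d₂ K′.
runT : Tm 5
runT = switch (var (# 0))
  ( ret (lit 0) ∷ ret (suc x) ∷ ret x ∷ ret (fst x) ∷ ret (snd x)
  ∷ run m₁ x (quadT (lit 1) m₂ x K)
  ∷ run m₂ x (quadT (lit 2) m₁ (lit 0) K)
  ∷ ifz x₂
      (run m₁ (fst x) K)
      (run m (pr (fst x) (predT x₂)) (quadT (lit 3) m₂ x K))
  ∷ run m₁ (pr x (lit 0)) (quadT (lit 4) m₁ (pr x (lit 0)) K)
  -- Tags above 8 decode to `Z`.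
  ∷ []) (ret (lit 0))
  where
  x₂ = var (# 1)
  m  = var (# 2)
  x  = var (# 3)
  K  = var (# 4)
  m₁ = fst (snd m)
  m₂ = snd (snd m)
  ret : Tm 5 → Tm 5
  ret v = quadT (lit 2) v (lit 0) K
  run : Tm 5 → Tm 5 → Tm 5 → Tm 5
  run a b k = quadT (lit 1) a b k

-- Frame 1 awaits the left value of a `P` and frame 5 the right one; frame 2 awaits the argument of
-- a `C`, frame 3 the previous value of a `Rec`, frame 4 a test of a `Mu`. The empty stack 0 unpacks
-- to tag 0, which halts the machine.
retT : Tm 5
retT = switch tag
  ( lit 0
  ∷ run d₁ d₂ (quadT (lit 5) v (lit 0) K)
  ∷ run d₁ v K
  ∷ run d₁ (pr (fst d₂) (pr (predT (snd d₂)) v)) K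
  ∷ ifz v (ret (snd d₂)) (run d₁ w⁺ (quadT (lit 4) d₁ w⁺ K))
  ∷ []) (ret (pr d₁ v))
  where
  tag = var (# 0)
  d₁  = var (# 1)
  d₂  = var (# 2)
  K   = var (# 3)
  v   = var (# 4)
  w⁺ = pr (fst d₂) (suc (snd d₂))
  ret : Tm 5 → Tm 5
  ret w = quadT (lit 2) w (lit 0) K
  run : Tm 5 → Tm 5 → Tm 5 → Tm 5
  run a b k = quadT (lit 1) a b k

stepT : Tm 4
stepT = switch (var (# 0))
  ( lit 0
  ∷ call runT (fst (var (# 1)) ∷ snd (var (# 2)) ∷ var (# 1) ∷ var (# 2) ∷ K ∷ [])
  ∷ []) (call retT (fst K ∷ fst (snd K) ∷ fst (snd (snd K)) ∷ snd (snd (snd K)) ∷ var (# 1) ∷ []))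
  where K = var (# 3)

q₁ q₂ q₃ q₄ : ℕ → ℕ
q₁ s = π₁ s
q₂ s = π₁ (π₂ s)
q₃ s = π₁ (π₂ (π₂ s))
q₄ s = π₂ (π₂ (π₂ s))

-- Opaque, because normalising the numerals inside a machine state is expensive.
opaque
  quad : ℕ → ℕ → ℕ → ℕ → ℕ
  quad a b c d = pair a (pair b (pair c d))

  step : ℕ → ℕ
  step s = ⟦ stepT ⟧ (q₁ s ∷ q₂ s ∷ q₃ s ∷ q₄ s ∷ [])

  step-def : ∀ s → step s ≡ ⟦ stepT ⟧ (q₁ s ∷ q₂ s ∷ q₃ s ∷ q₄ s ∷ [])
  step-def s = refl

  step-zero : step 0 ≡ 0
  step-zero = refl

  quad≢0 : ∀ a b c d → quad (suc a) b c d ≢ 0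
  quad≢0 a b c d ()

  quad-def : ∀ a b c d → quad a b c d ≡ pair a (pair b (pair c d))
  quad-def a b c d = refl

  ⟦quadT⟧ : ∀ {n} (a b c d : Tm n) ρ →
            ⟦ quadT a b c d ⟧ ρ ≡ quad (⟦ a ⟧ ρ) (⟦ b ⟧ ρ) (⟦ c ⟧ ρ) (⟦ d ⟧ ρ)
  ⟦quadT⟧ a b c d ρ = refl

runs : ℕ → ℕ → ℕ
runs zero    s = s
runs (suc t) s = step (runs t s)

cong₄ : ∀ (f : ℕ → ℕ → ℕ → ℕ → ℕ) {a a′ b b′ c c′ d d′} →
        a ≡ a′ → b ≡ b′ → c ≡ c′ → d ≡ d′ → f a b c d ≡ f a′ b′ c′ d′
cong₄ f refl refl refl refl = refl

with-tuple₄ : ∀ (f : ℕ → ℕ → ℕ → ℕ → ℕ) s a b c d → s ≡ pair a (pair b (pair c d)) →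
              f (q₁ s) (q₂ s) (q₃ s) (q₄ s) ≡ f a b c d
with-tuple₄ f s a b c d refl = cong₄ f (π₁-pair a (pair b (pair c d)))
  (trans (cong π₁ (π₂-pair a (pair b (pair c d)))) (π₁-pair b (pair c d)))
  (trans (cong π₁ eq) (π₁-pair c d))
  (trans (cong π₂ eq) (π₂-pair c d))
  where
  eq : π₂ (π₂ s) ≡ pair c d
  eq = trans (cong π₂ (π₂-pair a (pair b (pair c d)))) (π₂-pair b (pair c d))

with-quad : ∀ (f : ℕ → ℕ → ℕ → ℕ → ℕ) s a b c d → s ≡ quad a b c d →
            f (q₁ s) (q₂ s) (q₃ s) (q₄ s) ≡ f a b c d
with-quad f s a b c d eq = with-tuple₄ f s a b c d (trans eq (quad-def a b c d))

step-quad : ∀ s a b c d → s ≡ quad a b c d → step s ≡ ⟦ stepT ⟧ (a ∷ b ∷ c ∷ d ∷ [])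
step-quad s a b c d eq = trans (step-def s)
  (with-quad (λ a b c d → ⟦ stepT ⟧ (a ∷ b ∷ c ∷ d ∷ [])) s a b c d eq)

step-run : ∀ m x K {t n} → π₁ m ≡ t → π₂ x ≡ n →
           step (quad 1 m x K) ≡ ⟦ runT ⟧ (t ∷ n ∷ m ∷ x ∷ K ∷ [])
step-run m x K eq eq′ = trans (step-quad (quad 1 m x K) 1 m x K refl)
  (cong₂ (λ t n → ⟦ runT ⟧ (t ∷ n ∷ m ∷ x ∷ K ∷ [])) eq eq′)

step-ret : ∀ v t d₁ d₂ K →
           step (quad 2 v 0 (quad t d₁ d₂ K)) ≡ ⟦ retT ⟧ (t ∷ d₁ ∷ d₂ ∷ K ∷ v ∷ [])
step-ret v t d₁ d₂ K = trans (step-quad (quad 2 v 0 F) 2 v 0 F refl)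
  (with-quad (λ t d₁ d₂ K → ⟦ retT ⟧ (t ∷ d₁ ∷ d₂ ∷ K ∷ v ∷ [])) F t d₁ d₂ K refl)
  where F = quad t d₁ d₂ K

opaque
  unfolding quad

  step-ret₀ : ∀ v → step (quad 2 v 0 0) ≡ 0
  step-ret₀ v = step-quad (quad 2 v 0 0) 2 v 0 0 refl

  step-ret₁ : ∀ v m x K → step (quad 2 v 0 (quad 1 m x K)) ≡ quad 1 m x (quad 5 v 0 K)
  step-ret₁ v m x K = step-ret v 1 m x K

  step-ret₂ : ∀ v m K → step (quad 2 v 0 (quad 2 m 0 K)) ≡ quad 1 m v K
  step-ret₂ v m K = step-ret v 2 m 0 K

  step-ret₃ : ∀ v m x K n → π₂ x ≡ suc n →
              step (quad 2 v 0 (quad 3 m x K)) ≡ quad 1 m (pair (π₁ x) (pair n v)) K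
  step-ret₃ v m x K n eq = trans (step-ret v 3 m x K)
    (cong (λ k → quad 1 m (pair (π₁ x) (pair (⟦ predT (var (# 0)) ⟧ (k ∷ [])) v)) K) eq)

  step-ret₄-zero : ∀ m w K → step (quad 2 0 0 (quad 4 m w K)) ≡ quad 2 (π₂ w) 0 K
  step-ret₄-zero m w K = step-ret 0 4 m w K

  step-ret₄-suc : ∀ n m w K → let w⁺ = pair (π₁ w) (suc (π₂ w)) in
                  step (quad 2 (suc n) 0 (quad 4 m w K)) ≡ quad 1 m w⁺ (quad 4 m w⁺ K)
  step-ret₄-suc n m w K = step-ret (suc n) 4 m w K

  step-ret₅ : ∀ v u K → step (quad 2 v 0 (quad 5 u 0 K)) ≡ quad 2 (pair u v) 0 K
  step-ret₅ v u K = step-ret v 5 u 0 K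

-- Correctness of the machine

-- One cannot match on the stuck term `φ m`. The view supplies its shape together with the
-- transition that goes with it, so both directions of the correctness proof can split on it.
data View (m : ℕ) : Code → Set where
  vZ : (∀ x K → step (quad 1 m x K) ≡ quad 2 0 0 K) → View m Z
  vS : (∀ x K → step (quad 1 m x K) ≡ quad 2 (suc x) 0 K) → View m S
  vI : (∀ x K → step (quad 1 m x K) ≡ quad 2 x 0 K) → View m I
  vL : (∀ x K → step (quad 1 m x K) ≡ quad 2 (π₁ x) 0 K) → View m L
  vR : (∀ x K → step (quad 1 m x K) ≡ quad 2 (π₂ x) 0 K) → View m R
  vP : (∀ x K → step (quad 1 m x K) ≡ quad 1 (lhs m) x (quad 1 (rhs m) x K)) →
       View m (P (φ (lhs m)) (φ (rhs m)))
  vC : (∀ x K → step (quad 1 m x K) ≡ quad 1 (rhs m) x (quad 2 (lhs m) 0 K)) →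
       View m (C (φ (lhs m)) (φ (rhs m)))
  vRec : (∀ x K → π₂ x ≡ 0 → step (quad 1 m x K) ≡ quad 1 (lhs m) (π₁ x) K) →
         (∀ x K n → π₂ x ≡ suc n →
           step (quad 1 m x K) ≡ quad 1 m (pair (π₁ x) n) (quad 3 (rhs m) x K)) →
         View m (Rec (φ (lhs m)) (φ (rhs m)))
  vMu : (∀ x K → step (quad 1 m x K) ≡
          quad 1 (lhs m) (pair x 0) (quad 4 (lhs m) (pair x 0) K)) →
        View m (Mu (φ (lhs m)))

opaque
  unfolding quad

  view : ∀ m → View m (φ m)
  view m = go (π₁ m) refl
    where
    φ₀ : ∀ m → π₁ m ≡ 0 → φ m ≡ Z
    φ₀ m eq rewrite eq = refl
    φ₁ : ∀ m → π₁ m ≡ 1 → φ m ≡ S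
    φ₁ m eq rewrite eq = refl
    φ₂ : ∀ m → π₁ m ≡ 2 → φ m ≡ I
    φ₂ m eq rewrite eq = refl
    φ₃ : ∀ m → π₁ m ≡ 3 → φ m ≡ L
    φ₃ m eq rewrite eq = refl
    φ₄ : ∀ m → π₁ m ≡ 4 → φ m ≡ R
    φ₄ m eq rewrite eq = refl
    φ₉ : ∀ t m → π₁ m ≡ 9 + t → φ m ≡ Z
    φ₉ t m eq rewrite eq = refl

    go : ∀ t → π₁ m ≡ t → View m (φ m)
    go 0 eq = subst (View m) (sym (φ₀ m eq)) (vZ λ x K → step-run m x K eq refl)
    go 1 eq = subst (View m) (sym (φ₁ m eq)) (vS λ x K → step-run m x K eq refl)
    go 2 eq = subst (View m) (sym (φ₂ m eq)) (vI λ x K → step-run m x K eq refl)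
    go 3 eq = subst (View m) (sym (φ₃ m eq)) (vL λ x K → step-run m x K eq refl)
    go 4 eq = subst (View m) (sym (φ₄ m eq)) (vR λ x K → step-run m x K eq refl)
    go 5 eq = subst (View m) (sym (φ-P m eq)) (vP λ x K → step-run m x K eq refl)
    go 6 eq = subst (View m) (sym (φ-C m eq)) (vC λ x K → step-run m x K eq refl)
    go 7 eq = subst (View m) (sym (φ-Rec m eq))
      (vRec (λ x K eq′ → step-run m x K eq eq′) (λ x K n eq′ → step-run m x K eq eq′))
    go 8 eq = subst (View m) (sym (φ-Mu m eq)) (vMu λ x K → step-run m x K eq refl)
    go (suc (suc (suc (suc (suc (suc (suc (suc (suc t))))))))) eq =
      subst (View m) (sym (φ₉ t m eq)) (vZ λ x K → step-run m x K eq refl)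

runs-step : ∀ t s → runs (suc t) s ≡ runs t (step s)
runs-step zero    s = refl
runs-step (suc t) s = cong step (runs-step t s)

runs-+ : ∀ t t′ s → runs (t + t′) s ≡ runs t (runs t′ s)
runs-+ zero    t′ s = refl
runs-+ (suc t) t′ s = cong step (runs-+ t t′ s)

runs-halted : ∀ t → runs t 0 ≡ 0
runs-halted zero    = refl
runs-halted (suc t) = trans (cong step (runs-halted t)) step-zero

runs-mono : ∀ {t t′} s → t ≤ t′ → runs t s ≡ 0 → runs t′ s ≡ 0
runs-mono {t} {t′} s le h = trans (cong (λ k → runs k s) (sym (m∸n+n≡m le)))
  (trans (runs-+ (t′ ∸ t) t s) (trans (cong (runs (t′ ∸ t)) h) (runs-halted (t′ ∸ t))))

infix 4 _↠_
data _↠_ : ℕ → ℕ → Set where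
  done : ∀ {s} → s ↠ s
  _▸_  : ∀ {s s′ s″} → step s ≡ s′ → s′ ↠ s″ → s ↠ s″

infixr 5 _▸_ _▸▸_

_▸▸_ : ∀ {s s′ s″} → s ↠ s′ → s′ ↠ s″ → s ↠ s″
done    ▸▸ q = q
(e ▸ p) ▸▸ q = e ▸ p ▸▸ q

↠⇒runs : ∀ {s s′} → s ↠ s′ → ∃ λ t → runs t s ≡ s′
↠⇒runs done = 0 , refl
↠⇒runs {s} (e ▸ p) with ↠⇒runs p
... | t , h = suc t , trans (runs-step t s) (trans (cong (runs t) e) h)

mutual
  machine-complete : ∀ {c x v} m → View m c → Ev c x v → ∀ K → quad 1 m x K ↠ quad 2 v 0 K
  machine-complete {x = x} m (vZ st) evZ K = st x K ▸ done
  machine-complete {x = x} m (vS st) evS K = st x K ▸ done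
  machine-complete {x = x} m (vI st) evI K = st x K ▸ done
  machine-complete {x = x} m (vL st) evL K = st x K ▸ done
  machine-complete {x = x} m (vR st) evR K = st x K ▸ done
  machine-complete {x = x} m (vP st) (evP {a = a} {b} d d′) K =
    st x K ▸ machine-complete (lhs m) (view (lhs m)) d _ ▸▸
    step-ret₁ a (rhs m) x K ▸ machine-complete (rhs m) (view (rhs m)) d′ _ ▸▸
    step-ret₅ b a K ▸ done
  machine-complete {x = x} m (vC st) (evC {a = a} d d′) K =
    st x K ▸ machine-complete (rhs m) (view (rhs m)) d _ ▸▸
    step-ret₂ a (lhs m) K ▸ machine-complete (lhs m) (view (lhs m)) d′ K
  machine-complete {x = x} m (vRec st _) (evRec0 eq d) K =
    st x K eq ▸ machine-complete (lhs m) (view (lhs m)) d K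
  machine-complete {x = x} m w@(vRec _ st) (evRecS {n = n} {h} eq d d′) K =
    st x K n eq ▸ machine-complete m w d _ ▸▸
    step-ret₃ h (rhs m) x K n eq ▸
    machine-complete (rhs m) (view (rhs m)) d′ K
  machine-complete {x = x} m (vMu st) (evMu d) K =
    st x K ▸ search-complete (lhs m) d K

  search-complete : ∀ {w v} m → Search (φ m) w v → ∀ K →
                    quad 1 m w (quad 4 m w K) ↠ quad 2 v 0 K
  search-complete {w} m (found d) K =
    machine-complete m (view m) d _ ▸▸ step-ret₄-zero m w K ▸ done
  search-complete {w} m (next {n = n} d d′) K =
    machine-complete m (view m) d _ ▸▸ step-ret₄-suc n m w K ▸ search-complete m d′ K

Halts : ℕ → ℕ → Set
Halts t s = runs t s ≡ 0

-- Later s t says that s halts in fewer than t steps; the constructor form makes the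
-- recursion in machine-sound structural.
data Later (s : ℕ) : ℕ → Set where
  later : ∀ t → Halts t s → Later s (suc t)

advance : ∀ t s {s′} → s ≢ 0 → step s ≡ s′ → Halts t s → Later s′ t
advance zero    s nz e h = ⊥-elim (nz h)
advance (suc t) s nz e h = later t (trans (cong (runs t) (sym e)) (trans (sym (runs-step t s)) h))

advance-run : ∀ t m x K {s′} → step (quad 1 m x K) ≡ s′ → Halts t (quad 1 m x K) → Later s′ t
advance-run t m x K = advance t (quad 1 m x K) (quad≢0 0 m x K)

advance-ret : ∀ t v K {s′} → step (quad 2 v 0 K) ≡ s′ → Halts t (quad 2 v 0 K) → Later s′ t
advance-ret t v K = advance t (quad 2 v 0 K) (quad≢0 1 v 0 K)

later-suc : ∀ {s t} → Later s t → Later s (suc t)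
later-suc {s} (later t h) = later (suc t) (runs-mono s (n≤1+n t) h)

mutual
  -- A halting run above `K` must at some point return a value to `K`, with strictly fewer steps
  -- left. These steps give the halting hypothesis for the next subcomputation, so the induction is
  -- on `t`; the code itself need not shrink, as the recursive call of a `Rec` and the rounds of a
  -- search show.
  machine-sound : ∀ t {c} m → View m c → ∀ x K → Halts t (quad 1 m x K) →
                  ∃ λ v → Ev c x v × Later (quad 2 v 0 K) t
  machine-sound t m (vZ st) x K h = 0 , evZ , advance-run t m x K (st x K) h
  machine-sound t m (vS st) x K h = suc x , evS , advance-run t m x K (st x K) h
  machine-sound t m (vI st) x K h = x , evI , advance-run t m x K (st x K) h
  machine-sound t m (vL st) x K h = π₁ x , evL , advance-run t m x K (st x K) h
  machine-sound t m (vR st) x K h = π₂ x , evR , advance-run t m x K (st x K) h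
  machine-sound t m (vP st) x K h with advance-run t m x K (st x K) h
  ... | later t h with machine-sound t (lhs m) (view (lhs m)) x (quad 1 (rhs m) x K) h
  ... | a , d , later t h with advance-ret t a (quad 1 (rhs m) x K) (step-ret₁ a (rhs m) x K) h
  ... | later t h with machine-sound t (rhs m) (view (rhs m)) x (quad 5 a 0 K) h
  ... | b , d′ , later t h with advance-ret t b (quad 5 a 0 K) (step-ret₅ b a K) h
  ... | l = pair a b , evP d d′ , later-suc (later-suc (later-suc (later-suc l)))
  machine-sound t m (vC st) x K h with advance-run t m x K (st x K) h
  ... | later t h with machine-sound t (rhs m) (view (rhs m)) x (quad 2 (lhs m) 0 K) h
  ... | a , d , later t h with advance-ret t a (quad 2 (lhs m) 0 K) (step-ret₂ a (lhs m) K) h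
  ... | later t h with machine-sound t (lhs m) (view (lhs m)) a K h
  ... | b , d′ , l = b , evC d d′ , later-suc (later-suc (later-suc l))
  machine-sound t m w@(vRec st₀ st₊) x K h with π₂ x in eq
  ... | zero with advance-run t m x K (st₀ x K eq) h
  ... | later t h with machine-sound t (lhs m) (view (lhs m)) (π₁ x) K h
  ... | v , d , l = v , evRec0 eq d , later-suc l
  machine-sound t m w@(vRec st₀ st₊) x K h | suc n with advance-run t m x K (st₊ x K n eq) h
  ... | later t h with machine-sound t m w (pair (π₁ x) n) (quad 3 (rhs m) x K) h
  ... | a , d , later t h with advance-ret t a (quad 3 (rhs m) x K) (step-ret₃ a (rhs m) x K n eq) h
  ... | later t h with machine-sound t (rhs m) (view (rhs m)) (pair (π₁ x) (pair n a)) K h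
  ... | v , d′ , l = v , evRecS eq d d′ , later-suc (later-suc (later-suc l))
  machine-sound t m (vMu st) x K h with advance-run t m x K (st x K) h
  ... | later t h with search-sound t (lhs m) (pair x 0) K h
  ... | v , d , l = v , evMu d , later-suc l

  search-sound : ∀ t m w K → Halts t (quad 1 m w (quad 4 m w K)) →
                 ∃ λ v → Search (φ m) w v × Later (quad 2 v 0 K) t
  search-sound t m w K h with machine-sound t m (view m) w (quad 4 m w K) h
  ... | zero , d , later t h = π₂ w , found d ,
    later-suc (advance-ret t 0 (quad 4 m w K) (step-ret₄-zero m w K) h)
  ... | suc n , d , later t h with advance-ret t (suc n) (quad 4 m w K) (step-ret₄-suc n m w K) h
  ... | later t h with search-sound t m (pair (π₁ w) (suc (π₂ w))) K h
  ... | v , d′ , l = v , next d d′ , later-suc (later-suc l)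

start : ℕ → ℕ → ℕ
start e x = quad 1 e x 0

W⇔halts : ∀ e x → W e x ⇔ (∃ λ t → Halts t (start e x))
W⇔halts e x = mk⇔
  (λ (v , k , h) → ↠⇒runs (machine-complete e (view e) (eval-sound k (φ e) x h) 0 ▸▸
                           step-ret₀ v ▸ done))
  (λ (t , h) → let (v , d , _) = machine-sound t e (view e) x 0 h
                   (k , p)     = eval-complete d
               in v , k , p k ≤-refl)

-- The value is the machine state itself: as 0 is the halted state, it can be used directly as a
-- truth value.
haltsT : ∀ {n} → Tm n → Tm n → Tm n → Tm n
haltsT t e x = rec (quadT (lit 1) e x (lit 0)) (call stepT (unquadT (var (# 1)))) t

⟦haltsT⟧ : ∀ {n} (t e x : Tm n) ρ → ⟦ haltsT t e x ⟧ ρ ≡ runs (⟦ t ⟧ ρ) (start (⟦ e ⟧ ρ) (⟦ x ⟧ ρ))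
⟦haltsT⟧ t e x ρ = go (⟦ t ⟧ ρ)
  where
  s₀ = start (⟦ e ⟧ ρ) (⟦ x ⟧ ρ)
  go : ∀ k → natrec (⟦ quadT (lit 1) e x (lit 0) ⟧ ρ)
               (λ n h → ⟦ stepT ⟧ (q₁ h ∷ q₂ h ∷ q₃ h ∷ q₄ h ∷ [])) k ≡ runs k s₀
  go zero    = ⟦quadT⟧ (lit 1) e x (lit 0) ρ
  go (suc k) = trans (sym (step-def _)) (cong step (go k))

-- Binary digits and cardinality as terms

natrec-cong : ∀ {a a′ g g′} → a ≡ a′ → (∀ n h → g n h ≡ g′ n h) →
              ∀ n → natrec a g n ≡ natrec a′ g′ n
natrec-cong eq h zero    = eq
natrec-cong {g = g} eq h (suc n) = trans (cong (g n) (natrec-cong eq h n)) (h n _)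

addT : Tm 2
addT = rec (var (# 1)) (suc (var (# 1))) (var (# 0))

⟦addT⟧ : ∀ m n → ⟦ addT ⟧ (m ∷ n ∷ []) ≡ m + n
⟦addT⟧ zero    n = refl
⟦addT⟧ (suc m) n = cong suc (⟦addT⟧ m n)

parityT halfT cardT : Tm 1
parityT = rec (lit 0) (ifz (var (# 1)) (lit 1) (lit 0)) (var (# 0))
halfT   = rec (lit 0) (call addT (call parityT (var (# 0) ∷ []) ∷ var (# 1) ∷ [])) (var (# 0))

bitT : Tm 2
bitT = call parityT (rec (var (# 0)) (call halfT (var (# 1) ∷ [])) (var (# 1)) ∷ [])

cardT = rec (lit 0) (call addT (call bitT (var (# 2) ∷ var (# 0) ∷ []) ∷ var (# 1) ∷ [])) (var (# 0))

suc%2 : ∀ n → suc n % 2 ≡ if-zero (n % 2) 1 0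
suc%2 zero          = refl
suc%2 (suc zero)    = refl
suc%2 (suc (suc n)) = suc%2 n

2+/2 : ∀ n → suc (suc n) / 2 ≡ suc (n / 2)
2+/2 n = m/n≡1+[m∸n]/n {suc (suc n)} {2} (s≤s (s≤s z≤n))

suc/2 : ∀ n → suc n / 2 ≡ n % 2 + n / 2
suc/2 zero          = refl
suc/2 (suc zero)    = refl
suc/2 (suc (suc n)) = begin
  suc (suc (suc n)) / 2         ≡⟨ 2+/2 (suc n) ⟩
  suc (suc n / 2)               ≡⟨ cong suc (suc/2 n) ⟩
  suc (n % 2 + n / 2)           ≡⟨ +-suc (n % 2) (n / 2) ⟨
  n % 2 + suc (n / 2)           ≡⟨ cong (n % 2 +_) (2+/2 n) ⟨
  n % 2 + suc (suc n) / 2       ∎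
  where open ≡-Reasoning

⟦parityT⟧ : ∀ n → ⟦ parityT ⟧ (n ∷ []) ≡ n % 2
⟦parityT⟧ zero    = refl
⟦parityT⟧ (suc n) = trans (cong (λ h → if-zero h 1 0) (⟦parityT⟧ n)) (sym (suc%2 n))

⟦halfT⟧ : ∀ n → ⟦ halfT ⟧ (n ∷ []) ≡ n / 2
⟦halfT⟧ zero    = refl
⟦halfT⟧ (suc n) = trans (⟦addT⟧ (⟦ parityT ⟧ (n ∷ [])) (⟦ halfT ⟧ (n ∷ [])))
  (trans (cong₂ _+_ (⟦parityT⟧ n) (⟦halfT⟧ n)) (sym (suc/2 n)))

halve : ℕ → ℕ → ℕ
halve u w = natrec u (λ _ h → h / 2) w

-- `bit` halves before it recurses, `natrec` afterwards; this reconciles the two orders.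
halve-/2 : ∀ u w → halve (u / 2) w ≡ halve u w / 2
halve-/2 u zero    = refl
halve-/2 u (suc w) = cong (_/ 2) (halve-/2 u w)

bit≡halve%2 : ∀ u w → bit u w ≡ halve u w % 2
bit≡halve%2 u zero    = refl
bit≡halve%2 u (suc w) = trans (bit≡halve%2 (u / 2) w) (cong (_% 2) (halve-/2 u w))

⟦bitT⟧ : ∀ u w → ⟦ bitT ⟧ (u ∷ w ∷ []) ≡ bit u w
⟦bitT⟧ u w = trans (⟦parityT⟧ (natrec u (λ _ h → ⟦ halfT ⟧ (h ∷ [])) w)) (trans
  (cong (_% 2) (natrec-cong {u} refl (λ _ h → ⟦halfT⟧ h) w)) (sym (bit≡halve%2 u w)))

bit<2 : ∀ u w → bit u w < 2
bit<2 u w = subst (_< 2) (sym (bit≡halve%2 u w)) (m%n<n (halve u w) 2)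

bit≢1⇒≡0 : ∀ u w → bit u w ≢ 1 → bit u w ≡ 0
bit≢1⇒≡0 u w h with bit u w | bit<2 u w
... | 0 | _ = refl
... | 1 | _ = ⊥-elim (h refl)
... | suc (suc _) | s≤s (s≤s ())

∈D⇒< : ∀ u w → w ∈D u → w < u
∈D⇒< (suc u) zero    eq = z<s
∈D⇒< zero    (suc w) eq with ∈D⇒< 0 w eq
... | ()
∈D⇒< (suc u) (suc w) eq = ≤-<-trans (∈D⇒< (suc u / 2) w eq) (m/n<m (suc u) 2 (s≤s (s≤s z≤n)))

count : ℕ → ℕ → ℕ
count u zero    = 0
count u (suc n) = bit u n + count u n

count≡ : ∀ u n → length (filter (λ x → bit u x ≟ 1) (upTo n)) ≡ count u n
count≡ u zero    = refl
count≡ u (suc n) = begin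
  length (filter P? (upTo (suc n)))                ≡⟨ cong (length ∘ filter P?) (upTo-∷ʳ n) ⟨
  length (filter P? (upTo n ++ [ n ]))             ≡⟨ cong length (filter-++ P? (upTo n) [ n ]) ⟩
  length (filter P? (upTo n) ++ filter P? [ n ])   ≡⟨ length-++ (filter P? (upTo n)) ⟩
  length (filter P? (upTo n)) + length (filter P? [ n ]) ≡⟨ cong₂ _+_ (count≡ u n) last ⟩
  count u n + bit u n                              ≡⟨ +-comm (count u n) (bit u n) ⟩
  bit u n + count u n                              ∎
  where
  open ≡-Reasoning
  P? = λ x → bit u x ≟ 1
  split : Dec (bit u n ≡ 1) → length (filter P? [ n ]) ≡ bit u n
  split (yes eq) = trans (cong length (filter-accept P? {n} {[]} eq)) (sym eq)
  split (no neq) = trans (cong length (filter-reject P? {n} {[]} neq)) (sym (bit≢1⇒≡0 u n neq))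
  last = split (bit u n ≟ 1)

card≡count : ∀ u → card u ≡ count u u
card≡count u = count≡ u u

⟦cardT⟧ : ∀ u → ⟦ cardT ⟧ (u ∷ []) ≡ card u
⟦cardT⟧ u = trans (go u) (sym (card≡count u))
  where
  f = λ w h → ⟦ addT ⟧ (⟦ bitT ⟧ (u ∷ w ∷ []) ∷ h ∷ [])
  go : ∀ n → natrec 0 f n ≡ count u n
  go zero    = refl
  go (suc n) = trans (⟦addT⟧ _ (natrec 0 f n)) (cong₂ _+_ (⟦bitT⟧ u n) (go n))

subT : Tm 2
subT = rec (var (# 0)) (predT (var (# 1))) (var (# 1))

⟦subT⟧ : ∀ m n → ⟦ subT ⟧ (m ∷ n ∷ []) ≡ m ∸ n
⟦subT⟧ m zero    = refl
⟦subT⟧ m (suc n) = trans (pred-nat (⟦ subT ⟧ (m ∷ n ∷ [])))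
  (trans (cong pred (⟦subT⟧ m n)) (pred[m∸n]≡m∸[1+n] m n))
  where
  pred-nat : ∀ k → natrec 0 (λ k _ → k) k ≡ pred k
  pred-nat zero    = refl
  pred-nat (suc k) = refl

-- The recursive matrix of MDS

-- From here on a term used as a relation holds when its value is 0.

iffT : ∀ {n} → Tm n → Tm n → Tm n
iffT a b = ifz a b (ifz b (lit 1) (lit 0))

notT : ∀ {n} → Tm n → Tm n
notT a = ifz a (lit 1) (lit 0)

andT : ∀ {n} → Tm n → Tm n → Tm n
andT a b = ifz a b (lit 1)

iff : ℕ → ℕ → ℕ
iff a b = if-zero a b (if-zero b 1 0)

iff-zero : ∀ a b → iff a b ≡ 0 ⇔ (a ≡ 0 ⇔ b ≡ 0)
iff-zero zero    b       = mk⇔ (λ h → mk⇔ (λ _ → h) (λ _ → refl)) (λ h → to h refl)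
iff-zero (suc a) zero    = mk⇔ (λ ()) (λ h → ⊥-elim (1+n≢0 (from h refl)))
iff-zero (suc a) (suc b) = mk⇔ (λ _ → mk⇔ (λ ()) (λ ())) (λ _ → refl)

not-zero : ∀ a → if-zero a 1 0 ≡ 0 ⇔ (a ≢ 0)
not-zero zero    = mk⇔ (λ ()) (λ h → ⊥-elim (h refl))
not-zero (suc a) = mk⇔ (λ _ ()) (λ _ → refl)

and-zero : ∀ a b → if-zero a b 1 ≡ 0 ⇔ (a ≡ 0 × b ≡ 0)
and-zero zero    b = mk⇔ (λ h → refl , h) proj₂
and-zero (suc a) b = mk⇔ (λ ()) (λ ())

all<-zero : ∀ (g : ℕ → ℕ) u →
            natrec 0 (λ w h → if-zero h (g w) 1) u ≡ 0 ⇔ (∀ w → w < u → g w ≡ 0)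
all<-zero g zero    = mk⇔ (λ _ _ ()) (λ _ → refl)
all<-zero g (suc u) = mk⇔
  (λ h w w<u → let (p , q) = to (and-zero A (g u)) h in case-≤ p q (m≤n⇒m<n∨m≡n (≤-pred w<u)))
  (λ h → from (and-zero A (g u)) (from (all<-zero g u) (λ w w<u → h w (m<n⇒m<1+n w<u)) , h u ≤-refl))
  where
  A = natrec 0 (λ w h → if-zero h (g w) 1) u
  case-≤ : A ≡ 0 → g u ≡ 0 → ∀ {w} → w < u ⊎ w ≡ u → g w ≡ 0
  case-≤ p q (inj₁ w<u)  = to (all<-zero g u) p _ w<u
  case-≤ p q (inj₂ refl) = q

opaque
  haltT : Tm 4
  haltT = haltsT (var (# 0)) (var (# 1)) (pr (var (# 2)) (var (# 3)))

  ⟦haltT⟧ : ∀ t e x w → ⟦ haltT ⟧ (t ∷ e ∷ x ∷ w ∷ []) ≡ runs t (start e (pair x w))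
  ⟦haltT⟧ t e x w =
    ⟦haltsT⟧ (var (# 0)) (var (# 1)) (pr (var (# 2)) (var (# 3))) (t ∷ e ∷ x ∷ w ∷ [])

agreeT : Tm 5
agreeT = iffT (call haltT (t ∷ e ∷ x ∷ w ∷ [])) (call haltT (t ∷ e ∷ y ∷ w ∷ []))
  where
  t = var (# 0)
  e = var (# 1)
  x = var (# 2)
  y = var (# 3)
  w = var (# 4)

HaltsAt : ℕ → ℕ → ℕ → ℕ → Set
HaltsAt e x w t = Halts t (start e (pair x w))

AgreeAt : ℕ → ℕ → ℕ → ℕ → ℕ → Set
AgreeAt e x y w t = HaltsAt e x w t ⇔ HaltsAt e y w t

⟦agreeT⟧ : ∀ t e x y w → ⟦ agreeT ⟧ (t ∷ e ∷ x ∷ y ∷ w ∷ []) ≡ 0 ⇔ AgreeAt e x y w t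
⟦agreeT⟧ t e x y w = subst (λ k → k ≡ 0 ⇔ AgreeAt e x y w t)
  (sym (cong₂ iff (⟦haltT⟧ t e x w) (⟦haltT⟧ t e y w)))
  (iff-zero (runs t (start e (pair x w))) (runs t (start e (pair y w))))

-- The bound `w < u` loses nothing by `∈D⇒<` and makes the first condition a bounded, hence
-- recursive, one.
SeparatedAt : ℕ → ℕ → ℕ → ℕ → ℕ → ℕ → Set
SeparatedAt e x u y z t = (∀ w → w < u → w ∈D u → AgreeAt e x y w t) × ¬ AgreeAt e x y z t

agreeOnT : Tm 6
agreeOnT = ifz (call bitT (u ∷ w ∷ [])) (lit 0) (call agreeT (t ∷ e ∷ x ∷ y ∷ w ∷ []))
  where
  w = var (# 0)
  t = var (# 1)
  e = var (# 2)
  x = var (# 3)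
  u = var (# 4)
  y = var (# 5)

⟦agreeOnT⟧ : ∀ w t e x u y → ⟦ agreeOnT ⟧ (w ∷ t ∷ e ∷ x ∷ u ∷ y ∷ []) ≡ 0 ⇔ (w ∈D u → AgreeAt e x y w t)
⟦agreeOnT⟧ w t e x u y = subst (λ k → if-zero k 0 A ≡ 0 ⇔ (w ∈D u → AgreeAt e x y w t))
  (sym (⟦bitT⟧ u w)) go
  where
  A = ⟦ agreeT ⟧ (t ∷ e ∷ x ∷ y ∷ w ∷ [])
  go : if-zero (bit u w) 0 A ≡ 0 ⇔ (w ∈D u → AgreeAt e x y w t)
  go with bit u w | bit<2 u w
  ... | 0 | _ = mk⇔ (λ _ ()) (λ _ → refl)
  ... | 1 | _ = mk⇔ (λ h _ → to (⟦agreeT⟧ t e x y w) h) (λ h → from (⟦agreeT⟧ t e x y w) (h refl))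
  ... | suc (suc _) | s≤s (s≤s ())

separatedT : Tm 6
separatedT = andT
  (rec (lit 0) (andT (var (# 1)) (call agreeOnT (w ∷ t′ ∷ e′ ∷ x′ ∷ u′ ∷ y′ ∷ []))) u)
  (notT (call agreeT (t ∷ e ∷ x ∷ y ∷ z ∷ [])))
  where
  e = var (# 0)
  x = var (# 1)
  u = var (# 2)
  y = var (# 3)
  z = var (# 4)
  t = var (# 5)
  w e′ x′ u′ y′ t′ : Tm 8
  w  = var (# 0)
  e′ = var (# 2)
  x′ = var (# 3)
  u′ = var (# 4)
  y′ = var (# 5)
  t′ = var (# 7)

⟦separatedT⟧ : ∀ e x u y z t →
  ⟦ separatedT ⟧ (e ∷ x ∷ u ∷ y ∷ z ∷ t ∷ []) ≡ 0 ⇔ SeparatedAt e x u y z t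
⟦separatedT⟧ e x u y z t = mk⇔
  (λ h → let (p , q) = to (and-zero all neg) h in
    (λ w w<u → to (⟦agreeOnT⟧ w t e x u y) (to (all<-zero g u) p w w<u)) ,
    λ a → to (not-zero agr) q (from (⟦agreeT⟧ t e x y z) a))
  (λ (p , q) → from (and-zero all neg)
    ( from (all<-zero g u) (λ w w<u → from (⟦agreeOnT⟧ w t e x u y) (p w w<u))
    , from (not-zero agr) (q ∘ to (⟦agreeT⟧ t e x y z))))
  where
  g   = λ w → ⟦ agreeOnT ⟧ (w ∷ t ∷ e ∷ x ∷ u ∷ y ∷ [])
  all = natrec 0 (λ w h → if-zero h (g w) 1) u
  agr = ⟦ agreeT ⟧ (t ∷ e ∷ x ∷ y ∷ z ∷ [])
  neg = if-zero agr 1 0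

-- p codes ⟨y,⟨z,s⟩⟩, and the stage t + s ranges over all stages from s on.
opaque
  ambiguousT : Tm 5
  ambiguousT = call separatedT
    (var (# 0) ∷ var (# 1) ∷ var (# 2) ∷ fst (var (# 3)) ∷ fst (snd (var (# 3))) ∷
     call addT (var (# 4) ∷ snd (snd (var (# 3))) ∷ []) ∷ [])

  ⟦ambiguousT⟧ : ∀ e x u p t → ⟦ ambiguousT ⟧ (e ∷ x ∷ u ∷ p ∷ t ∷ []) ≡ 0 ⇔
                 SeparatedAt e x u (π₁ p) (lhs p) (t + rhs p)
  ⟦ambiguousT⟧ e x u p t = subst
    (λ k → ⟦ separatedT ⟧ (e ∷ x ∷ u ∷ π₁ p ∷ lhs p ∷ k ∷ []) ≡ 0 ⇔
           SeparatedAt e x u (π₁ p) (lhs p) (t + rhs p))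
    (sym (⟦addT⟧ t (rhs p))) (⟦separatedT⟧ e x u (π₁ p) (lhs p) (t + rhs p))

eventually-all< : ∀ {Q : ℕ → ℕ → Set} n → (∀ w → w < n → Eventually (Q w)) →
                  Eventually (λ j → ∀ w → w < n → Q w j)
eventually-all< zero    h = 0 , λ _ _ _ ()
eventually-all< {Q} (suc n) h =
  eventually₂ (eventually-all< n (λ w lt → h w (m<n⇒m<1+n lt))) (h n ≤-refl)
    λ j q q′ w lt → case-≤ q q′ (m≤n⇒m<n∨m≡n (≤-pred lt))
  where
  case-≤ : ∀ {j w} → (∀ w → w < n → Q w j) → Q n j → w < n ⊎ w ≡ n → Q w j
  case-≤ q q′ (inj₁ lt)   = q _ lt
  case-≤ q q′ (inj₂ refl) = q′

Lang⇔halts : ∀ e x w → Lang e x w ⇔ ∃ (HaltsAt e x w)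
Lang⇔halts e x w = W⇔halts e (pair x w)

minimalT : Tm 6
minimalT = andT
  (notT (call ambiguousT (e ∷ x ∷ u ∷ a ∷ fst b ∷ [])))
  -- The difference vanishes exactly when `card u ≤ card a`; the second conjunct then holds
  -- outright.
  (ifz (call subT (call cardT (u ∷ []) ∷ call cardT (a ∷ []) ∷ [])) (lit 0)
    (call ambiguousT (e ∷ x ∷ a ∷ snd b ∷ c ∷ [])))
  where
  e = var (# 0)
  x = var (# 1)
  u = var (# 2)
  a = var (# 3)
  b = var (# 4)
  c = var (# 5)

-- Both halves of MDS₃ share the quantifiers ∀a ∃b ∀c: for DS₃, a is the code p and
-- π₁ b a stage refuting it; for minimality, a is u′, π₂ b a code for it and c a stage.
MinimalMatrix : ℕ → ℕ → ℕ → ℕ → ℕ → ℕ → Set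
MinimalMatrix e x u a b c =
  (⟦ ambiguousT ⟧ (e ∷ x ∷ u ∷ a ∷ π₁ b ∷ []) ≢ 0) ×
  (card a < card u → ⟦ ambiguousT ⟧ (e ∷ x ∷ a ∷ π₂ b ∷ c ∷ []) ≡ 0)

∸-zero : ∀ m n k → if-zero (m ∸ n) 0 k ≡ 0 ⇔ (n < m → k ≡ 0)
∸-zero m n k with m ∸ n in eq
... | zero  = mk⇔ (λ _ lt → ⊥-elim (<⇒≱ lt (m∸n≡0⇒m≤n eq))) (λ _ → refl)
... | suc d = mk⇔ (λ h _ → h) (λ h → h (m∸n≢0⇒n<m (λ z → 1+n≢0 (trans (sym eq) z))))

⟦minimalT⟧ : ∀ e x u a b c →
  ⟦ minimalT ⟧ (e ∷ x ∷ u ∷ a ∷ b ∷ c ∷ []) ≡ 0 ⇔ MinimalMatrix e x u a b c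
⟦minimalT⟧ e x u a b c = mk⇔
  (λ h → let (p , q) = to (and-zero nA guard) h in
    to (not-zero A) p , to (∸-zero (card u) (card a) A′) (trans (sym guard-eq) q))
  (λ (p , q) → from (and-zero nA guard)
    (from (not-zero A) p , trans guard-eq (from (∸-zero (card u) (card a) A′) q)))
  where
  A  = ⟦ ambiguousT ⟧ (e ∷ x ∷ u ∷ a ∷ π₁ b ∷ [])
  nA = if-zero A 1 0
  A′ = ⟦ ambiguousT ⟧ (e ∷ x ∷ a ∷ π₂ b ∷ c ∷ [])
  cu = ⟦ cardT ⟧ (u ∷ [])
  ca = ⟦ cardT ⟧ (a ∷ [])
  guard = if-zero (⟦ subT ⟧ (cu ∷ ca ∷ [])) 0 A′
  guard-eq : guard ≡ if-zero (card u ∸ card a) 0 A′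
  guard-eq = cong (λ k → if-zero k 0 A′)
    (trans (⟦subT⟧ cu ca) (cong₂ _∸_ (⟦cardT⟧ u) (⟦cardT⟧ a)))

MDS⇔MDS₃ : ∀ n → MDS n ⇔ MDS₃ (π₁ n) (lhs n) (rhs n)
MDS⇔MDS₃ n = mk⇔ ⇒ λ m → π₁ n , lhs n , rhs n ,
    sym (trans (cong (pair (π₁ n)) (pair-unpair (π₂ n))) (pair-unpair n)) , m
  where
  ⇒ : MDS n → MDS₃ (π₁ n) (lhs n) (rhs n)
  ⇒ (e , x , u , refl , m) = subst (λ e → MDS₃ e (lhs n) (rhs n)) (sym (π₁-pair e (pair x u)))
    (subst₂ (MDS₃ e) (sym (lhs-node e x u)) (sym (rhs-node e x u)) m)

matrixT : Tm 1
matrixT = call minimalT (fst n ∷ fst (snd n) ∷ snd (snd n) ∷ a ∷ b ∷ c ∷ [])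
  where
  q = var (# 0)
  n = fst q
  a = fst (snd q)
  b = fst (snd (snd q))
  c = snd (snd (snd q))

matrix-at : ∀ n a b c → ⟦ matrixT ⟧ (pair n (pair a (pair b c)) ∷ []) ≡
            ⟦ minimalT ⟧ (π₁ n ∷ lhs n ∷ rhs n ∷ a ∷ b ∷ c ∷ [])
matrix-at n a b c = with-tuple₄
  (λ n a b c → ⟦ minimalT ⟧ (π₁ n ∷ lhs n ∷ rhs n ∷ a ∷ b ∷ c ∷ []))
  (pair n (pair a (pair b c))) n a b c refl

-- Membership in Π⁰₃

module Classical (em : ExcludedMiddle 0ℓ) where

  dne : {A : Set} → ¬ ¬ A → A
  dne = decidable-stable em

  ¬∀⇒∃¬ : {A : Set} {Q : A → Set} → ¬ (∀ a → Q a) → ∃ λ a → ¬ Q a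
  ¬∀⇒∃¬ h = dne λ k → h λ a → dne λ k′ → k (a , k′)

  Lang-limit : ∀ e x w → Eventually (λ t → HaltsAt e x w t ⇔ Lang e x w)
  Lang-limit e x w with em {Lang e x w}
  ... | yes l = let (t , h) = to (Lang⇔halts e x w) l in
    t , λ j le → mk⇔ (λ _ → l) (λ _ → runs-mono (start e (pair x w)) le h)
  ... | no ¬l = 0 , λ j _ → mk⇔ (λ h → from (Lang⇔halts e x w) (j , h)) (⊥-elim ∘ ¬l)

  -- Agreement is not monotone in the stage, but it converges: halting persists, so each side
  -- changes its truth value at most once.
  agree-limit : ∀ e x y w → Eventually (λ t → AgreeAt e x y w t ⇔ (Lang e x w ⇔ Lang e y w))
  agree-limit e x y w = eventually₂ (Lang-limit e x w) (Lang-limit e y w) λ j p q →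
    mk⇔ (λ a → ⇔-trans (⇔-sym p) (⇔-trans a q)) (λ a → ⇔-trans p (⇔-trans a (⇔-sym q)))

  -- Only finitely many points matter, namely `z` and those below `u`, so some stage `s` lies beyond
  -- all their limits. Conversely, what holds at every stage from `s` on holds in the limit.
  ¬DS₃⇔ambiguous : ∀ e x u →
    (¬ DS₃ e x u) ⇔ (∃ λ p → ∀ t → ⟦ ambiguousT ⟧ (e ∷ x ∷ u ∷ p ∷ t ∷ []) ≡ 0)
  ¬DS₃⇔ambiguous e x u = mk⇔ ⇒ ⇐
    where
    ⇒ : ¬ DS₃ e x u → ∃ λ p → ∀ t → ⟦ ambiguousT ⟧ (e ∷ x ∷ u ∷ p ∷ t ∷ []) ≡ 0
    ⇒ ¬ds with ¬∀⇒∃¬ ¬ds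
    ... | y , h with ¬∀⇒∃¬ (λ same → h λ ¬same _ → ¬same same)
    ... | z , ¬z with eventually₂ (eventually-all< u λ w _ → agree-limit e x y w)
                                  (agree-limit e x y z) (λ _ → _,_)
    ... | s , lim = pair y (pair z s) , λ t → from (⟦ambiguousT⟧ e x u p t) (at t)
      where
      p = node y z s
      same : SameSet (Lang e x ∩D u) (Lang e y ∩D u)
      same = dne λ k → h λ _ s → k s
      agree : ∀ w → w ∈D u → Lang e x w ⇔ Lang e y w
      agree w w∈ = mk⇔ (λ l → proj₁ (to (same w) (l , w∈))) (λ l → proj₁ (from (same w) (l , w∈)))
      sep : ∀ t → SeparatedAt e x u y z (t + s)
      sep t = let (q , q′) = lim (t + s) (m≤n+m s t) in
        (λ w lt w∈ → from (q w lt) (agree w w∈)) , ¬z ∘ to q′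
      at : ∀ t → SeparatedAt e x u (π₁ p) (lhs p) (t + rhs p)
      at t = subst (λ y → SeparatedAt e x u y (lhs p) (t + rhs p)) (sym (π₁-pair y (pair z s)))
        (subst₂ (λ z s → SeparatedAt e x u y z (t + s)) (sym (lhs-node y z s)) (sym (rhs-node y z s))
          (sep t))

    ⇐ : (∃ λ p → ∀ t → ⟦ ambiguousT ⟧ (e ∷ x ∷ u ∷ p ∷ t ∷ []) ≡ 0) → ¬ DS₃ e x u
    ⇐ (p , h) ds = ds y ¬same λ w → mk⇔
        (λ (l , w∈) → to (agree w w∈) l , w∈) (λ (l , w∈) → from (agree w w∈) l , w∈)
      where
      y = π₁ p
      z = lhs p
      s = rhs p
      sep : ∀ t → SeparatedAt e x u y z (t + s)
      sep t = to (⟦ambiguousT⟧ e x u p t) (h t)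
      at-limit : ∀ w → ∃ λ t → AgreeAt e x y w (t + s) ⇔ (Lang e x w ⇔ Lang e y w)
      at-limit w = let (k , lim) = agree-limit e x y w in k , lim (k + s) (m≤m+n k s)
      agree : ∀ w → w ∈D u → Lang e x w ⇔ Lang e y w
      agree w w∈ = let (t , a) = at-limit w in to a (proj₁ (sep t) w (∈D⇒< u w w∈) w∈)
      ¬same : ¬ SameSet (Lang e x) (Lang e y)
      ¬same same = let (t , a) = at-limit z in proj₂ (sep t) (from a (same z))

  MDS₃⇔matrix : ∀ e x u → MDS₃ e x u ⇔ (∀ a → ∃ λ b → ∀ c → MinimalMatrix e x u a b c)
  MDS₃⇔matrix e x u = mk⇔ ⇒ ⇐
    where
    ⇒ : MDS₃ e x u → ∀ a → ∃ λ b → ∀ c → MinimalMatrix e x u a b c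
    ⇒ (ds , min) a with ¬∀⇒∃¬ (λ h → from (¬DS₃⇔ambiguous e x u) (a , h) ds) | card a <? card u
    ... | t , t≢0 | no ≮ = pair t 0 , λ c →
      subst (λ t → ⟦ ambiguousT ⟧ (e ∷ x ∷ u ∷ a ∷ t ∷ []) ≢ 0) (sym (π₁-pair t 0)) t≢0 ,
      λ lt → ⊥-elim (≮ lt)
    ... | t , t≢0 | yes lt = let (p , h) = to (¬DS₃⇔ambiguous e x a) (min a lt) in
      pair t p , λ c →
      subst (λ t → ⟦ ambiguousT ⟧ (e ∷ x ∷ u ∷ a ∷ t ∷ []) ≢ 0) (sym (π₁-pair t p)) t≢0 ,
      λ _ → subst (λ p → ⟦ ambiguousT ⟧ (e ∷ x ∷ a ∷ p ∷ c ∷ []) ≡ 0) (sym (π₂-pair t p)) (h c)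

    ⇐ : (∀ a → ∃ λ b → ∀ c → MinimalMatrix e x u a b c) → MDS₃ e x u
    -- With `a` set to the refuting code `p`, the matrix yields a stage `π₁ b` that contradicts
    -- `amb`. This conjunct does not mention `c`, so 0 will do.
    ⇐ h = dne (λ ¬ds → let (p , amb) = to (¬DS₃⇔ambiguous e x u) ¬ds
                           (b , m)   = h p
                       in proj₁ (m 0) (amb (π₁ b)))
        , λ u′ lt → let (b , m) = h u′ in
            from (¬DS₃⇔ambiguous e x u′) (π₂ b , λ c → proj₂ (m c) lt)

  MDS-Π⁰₃ : Π⁰₃ MDS
  MDS-Π⁰₃ = (λ q → ⟦ matrixT ⟧ (q ∷ [])) , Tm-recursive matrixT (λ _ → refl) , λ n → mk⇔
    (λ m a → let (b , h) = to (MDS₃⇔matrix _ _ _) (to (MDS⇔MDS₃ n) m) a in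
      b , λ c → trans (matrix-at n a b c) (from (⟦minimalT⟧ (π₁ n) (lhs n) (rhs n) a b c) (h c)))
    (λ h → from (MDS⇔MDS₃ n) (from (MDS₃⇔matrix _ _ _) λ a → let (b , k) = h a in
      b , λ c → to (⟦minimalT⟧ (π₁ n) (lhs n) (rhs n) a b c) (trans (sym (matrix-at n a b c)) (k c))))

-- Finite sets with at most one element

count≡0⇒∉D : ∀ u n → count u n ≡ 0 → ∀ w → w < n → ¬ (w ∈D u)
count≡0⇒∉D u (suc n) eq w lt w∈ with m≤n⇒m<n∨m≡n (≤-pred lt)
... | inj₁ lt′  = count≡0⇒∉D u n (m+n≡0⇒n≡0 (bit u n) eq) w lt′ w∈
... | inj₂ refl = 1+n≢0 (trans (sym w∈) (m+n≡0⇒m≡0 (bit u n) eq))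

count≤1⇒unique : ∀ u n → count u n ≤ 1 → ∃ λ d → ∀ w → w < n → w ∈D u → w ≡ d
count≤1⇒unique u zero    le = 0 , λ _ ()
count≤1⇒unique u (suc n) le with bit u n ≟ 1
... | yes eq = n , λ w lt w∈ → last w w∈ (m≤n⇒m<n∨m≡n (≤-pred lt))
  where
  last : ∀ w → w ∈D u → w < n ⊎ w ≡ n → w ≡ n
  last w w∈ (inj₂ eq′) = eq′
  last w w∈ (inj₁ lt)  = ⊥-elim (count≡0⇒∉D u n
    (n≤0⇒n≡0 (≤-pred (subst (λ k → k + count u n ≤ 1) eq le))) w lt w∈)
... | no neq with count≤1⇒unique u n (m+n≤o⇒n≤o (bit u n) le)
... | d , uniq = d , λ w lt w∈ → go w w∈ (m≤n⇒m<n∨m≡n (≤-pred lt))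
  where
  go : ∀ w → w ∈D u → w < n ⊎ w ≡ n → w ≡ d
  go w w∈ (inj₁ lt)   = uniq w lt w∈
  go w w∈ (inj₂ refl) = ⊥-elim (neq w∈)

-- This form treats the empty set and the singletons alike: `d` need not belong to the set.
card<2⇒unique : ∀ u → card u < 2 → ∃ λ d → ∀ w → w ∈D u → w ≡ d
card<2⇒unique u lt with count≤1⇒unique u u (subst (_≤ 1) (card≡count u) (≤-pred lt))
... | d , uniq = d , λ w w∈ → uniq w (∈D⇒< u w w∈) w∈

unique⇒count<2 : ∀ u d n → (∀ w → w ∈D u → w ≡ d) → count u n < 2
unique⇒count<2 u d zero    uniq = z<s
unique⇒count<2 u d (suc n) uniq with bit u n ≟ 1
... | yes eq = s≤s (≤-reflexive (cong₂ _+_ eq (below n ≤-refl)))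
  where
  below : ∀ m → m ≤ n → count u m ≡ 0
  below zero    le = refl
  below (suc m) le = cong₂ _+_
    (bit≢1⇒≡0 u m (λ eq′ → <-irrefl (trans (uniq m eq′) (sym (uniq n eq))) le))
    (below m (<⇒≤ le))
... | no neq rewrite bit≢1⇒≡0 u n neq = unique⇒count<2 u d n uniq

unique⇒card<2 : ∀ u d → (∀ w → w ∈D u → w ≡ d) → card u < 2
unique⇒card<2 u d uniq = subst (_< 2) (sym (card≡count u)) (unique⇒count<2 u d u uniq)

2^-/2 : ∀ d → 2 ^ suc d / 2 ≡ 2 ^ d
2^-/2 d = trans (cong (_/ 2) (*-comm 2 (2 ^ d))) (m*n/n≡m (2 ^ d) 2)

∈D-2^ : ∀ d → d ∈D (2 ^ d)
∈D-2^ zero    = refl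
∈D-2^ (suc d) = trans (cong (λ u → bit u d) (2^-/2 d)) (∈D-2^ d)

∈D-2^⇒≡ : ∀ d w → w ∈D (2 ^ d) → w ≡ d
∈D-2^⇒≡ zero    zero    eq = refl
∈D-2^⇒≡ zero    (suc w) eq with ∈D⇒< 0 w eq
... | ()
∈D-2^⇒≡ (suc d) zero    eq =
  ⊥-elim (0≢1+n (trans (sym (m*n%n≡0 (2 ^ d) 2)) (trans (cong (_% 2) (*-comm (2 ^ d) 2)) eq)))
∈D-2^⇒≡ (suc d) (suc w) eq =
  cong suc (∈D-2^⇒≡ d w (trans (cong (λ u → bit u w) (sym (2^-/2 d))) eq))

-- Domains of searches and the s-m-n theorem

W⇔Ev : ∀ e x → W e x ⇔ ∃ (Ev (φ e) x)
W⇔Ev e x = mk⇔ (λ (v , k , h) → v , eval-sound k (φ e) x h)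
  (λ (v , d) → let (k , h) = eval-complete d in v , k , h k ≤-refl)

module _ (t : Tm 1) where
  private f = compile₁ t

  search⇒zero : ∀ {w v} → Search f w v → ∃ λ c → ⟦ t ⟧ (pair (π₁ w) c ∷ []) ≡ 0
  search⇒zero {w} (found d) = π₂ w ,
    trans (cong (λ w → ⟦ t ⟧ (w ∷ [])) (pair-unpair w)) (Ev-functional (compile₁-correct t w) d)
  search⇒zero {w} (next _ s) with search⇒zero s
  ... | c , eq = c , subst (λ x → ⟦ t ⟧ (pair x c ∷ []) ≡ 0) (π₁-pair (π₁ w) (suc (π₂ w))) eq

  -- Induction on the distance `c` to a known zero; the search may stop before reaching it.
  zero⇒search : ∀ x c k → ⟦ t ⟧ (pair x (c + k) ∷ []) ≡ 0 → ∃ (Search f (pair x k))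
  zero⇒search x c k eq with ⟦ t ⟧ (pair x k ∷ []) in val
  zero⇒search x c k eq | zero = π₂ (pair x k) , found
    (subst (Ev f (pair x k)) val (compile₁-correct t (pair x k)))
  zero⇒search x zero    k eq | suc m = ⊥-elim (1+n≢0 (trans (sym val) eq))
  zero⇒search x (suc c) k eq | suc m
    with zero⇒search x c (suc k) (trans (cong (λ i → ⟦ t ⟧ (pair x i ∷ [])) (+-suc c k)) eq)
  ... | v , s = v , next (subst (Ev f (pair x k)) val (compile₁-correct t (pair x k)))
    (subst (λ w → Search f w v)
      (sym (cong₂ (λ a b → pair a (suc b)) (π₁-pair x k) (π₂-pair x k))) s)

  -- The searched function is total, so no earlier value can block the way to a zero.
  Mu-domain : ∀ x → ∃ (Ev (Mu f) x) ⇔ ∃ λ c → ⟦ t ⟧ (pair x c ∷ []) ≡ 0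
  Mu-domain x = mk⇔
    (λ { (v , evMu s) → let (c , eq) = search⇒zero s in
          c , subst (λ x → ⟦ t ⟧ (pair x c ∷ []) ≡ 0) (π₁-pair x 0) eq })
    (λ (c , eq) → let (v , s) = zero⇒search x c 0
                        (trans (cong (λ i → ⟦ t ⟧ (pair x i ∷ [])) (+-identityʳ c)) eq)
                  in v , evMu s)

nodeT : ∀ {n} → ℕ → Tm n → Tm n → Tm n
nodeT t a b = pr (lit t) (pr a b)

numeralT : Tm 1
numeralT = rec (lit ⌜ Z ⌝) (nodeT 6 (lit ⌜ S ⌝) (var (# 1))) (var (# 0))

⟦numeralT⟧ : ∀ n → ⟦ numeralT ⟧ (n ∷ []) ≡ ⌜ numeral n ⌝
⟦numeralT⟧ zero    = refl
⟦numeralT⟧ (suc n) = cong (node 6 ⌜ S ⌝) (⟦numeralT⟧ n)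

opaque
  -- The s-m-n function: `n` is hard-wired into the program as a numeral.
  specialise : Code → ℕ → ℕ
  specialise g n = ⌜ C g (P (numeral n) I) ⌝

  specialise-W : ∀ g n x → W (specialise g n) x ⇔ ∃ (Ev g (pair n x))
  specialise-W g n x = ⇔-trans (W⇔Ev (specialise g n) x)
    (subst (λ c → ∃ (Ev c x) ⇔ ∃ (Ev g (pair n x))) (sym (φ-⌜⌝ (C g (P (numeral n) I))))
      (mk⇔ (λ { (v , evC (evP d evI) d′) →
                 v , subst (λ k → Ev g (pair k x) v) (Ev-functional d (numeral-correct n)) d′ })
           (λ (v , d) → v , evC (evP (numeral-correct n) evI) d)))

  specialise-recursive : ∀ g x u → Recursive (λ n → triple (specialise g n) x u)
  specialise-recursive g x u = Tm-recursive
    (pr (nodeT 6 (lit ⌜ g ⌝) (nodeT 5 numeralT (lit ⌜ I ⌝))) (pr (lit x) (lit u)))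
    (λ n → cong (λ k → triple (node 6 ⌜ g ⌝ (node 5 k ⌜ I ⌝)) x u) (⟦numeralT⟧ n))

-- The reduction of a Π⁰₃ set to MDS

module Reduction (χ : ℕ → ℕ) (χ-rec : Recursive χ) where

  -- Here `c` refutes `b` as a witness for `i`. The shift by 2 reserves the points 0 and 1, whose
  -- singletons must never grow.
  Extra : ℕ → ℕ → ℕ → ℕ → Set
  Extra n 0             b c = ⊥
  Extra n 1             b c = ⊥
  Extra n (suc (suc i)) b c = χ (pair n (pair i (pair b c))) ≢ 0

  -- The language with index ⟨0,b⟩ is ℕ; the one with index ⟨d+1,b⟩ is {d}, or ℕ
  -- if there is a c with Extra n d b c.
  Member : ℕ → ℕ → ℕ → ℕ → ℕ → Set
  Member n zero    b z c = ⊤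
  Member n (suc d) b z c = z ≡ d ⊎ Extra n d b c

  ≡-zero : ∀ m n → if-zero (m ∸ n) (n ∸ m) 1 ≡ 0 ⇔ m ≡ n
  ≡-zero m n = mk⇔
    (λ h → let (p , q) = to (and-zero (m ∸ n) (n ∸ m)) h in ≤-antisym (m∸n≡0⇒m≤n p) (m∸n≡0⇒m≤n q))
    (λ { refl → from (and-zero (m ∸ m) (m ∸ m)) (n∸n≡0 m , n∸n≡0 m) })

  or-zero : ∀ a b → if-zero a 0 b ≡ 0 ⇔ (a ≡ 0 ⊎ b ≡ 0)
  or-zero zero    b = mk⇔ (λ _ → inj₁ refl) (λ _ → refl)
  or-zero (suc a) b = mk⇔ inj₂ λ { (inj₁ ()) ; (inj₂ eq) → eq }

  opaque
    memberT : Tm 5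
    memberT = ifz (var (# 1)) (lit 0)
      (ifz (ifz (call subT (z ∷ d ∷ [])) (call subT (d ∷ z ∷ [])) (lit 1)) (lit 0)
      (switch d (lit 1 ∷ lit 1 ∷ [])
        (notT (ext χ χ-rec (pr (var (# 0)) (pr (predT (predT d)) (pr (var (# 2)) (var (# 4)))))))))
      where
      d z : Tm 5
      d = predT (var (# 1))
      z = var (# 3)

    ⟦memberT⟧ : ∀ n a b z c → ⟦ memberT ⟧ (n ∷ a ∷ b ∷ z ∷ c ∷ []) ≡ 0 ⇔ Member n a b z c
    ⟦memberT⟧ n zero    b z c = mk⇔ (λ _ → tt) (λ _ → refl)
    ⟦memberT⟧ n (suc d) b z c = mk⇔
      (λ h → ⊎-map (to eq) (to (extra d)) (to (or-zero diff (rest d)) h))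
      (λ m → from (or-zero diff (rest d)) (⊎-map (from eq) (from (extra d)) m))
      where
      diff : ℕ
      diff = if-zero (⟦ subT ⟧ (z ∷ d ∷ [])) (⟦ subT ⟧ (d ∷ z ∷ [])) 1
      eq : diff ≡ 0 ⇔ z ≡ d
      eq = subst (λ k → k ≡ 0 ⇔ z ≡ d)
        (sym (cong₂ (λ k l → if-zero k l 1) (⟦subT⟧ z d) (⟦subT⟧ d z))) (≡-zero z d)
      rest : ℕ → ℕ
      rest d = ⟦ switch (var (# 0)) (lit 1 ∷ lit 1 ∷ [])
        (notT (ext χ χ-rec (pr (var (# 1)) (pr (predT (predT (var (# 0)))) (pr (var (# 2)) (var (# 3)))))))
        ⟧ (d ∷ n ∷ b ∷ c ∷ [])
      extra : ∀ d → rest d ≡ 0 ⇔ Extra n d b c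
      extra 0             = mk⇔ (λ ()) (λ ())
      extra 1             = mk⇔ (λ ()) (λ ())
      extra (suc (suc i)) = not-zero (χ (pair n (pair i (pair b c))))

  enumerateT : Tm 1
  enumerateT = call memberT (fst x ∷ fst j ∷ snd j ∷ snd (snd x) ∷ snd (var (# 0)) ∷ [])
    where
    x = fst (var (# 0))
    j = fst (snd x)

  enumerate-at : ∀ n j z c → ⟦ enumerateT ⟧ (pair (pair n (pair j z)) c ∷ []) ≡
                 ⟦ memberT ⟧ (n ∷ π₁ j ∷ π₂ j ∷ z ∷ c ∷ [])
  enumerate-at n j z c = cong₄ (λ n j z c → ⟦ memberT ⟧ (n ∷ π₁ j ∷ π₂ j ∷ z ∷ c ∷ []))
    (trans (cong π₁ eq) (π₁-pair n (pair j z)))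
    (trans (cong lhs eq) (lhs-node n j z))
    (trans (cong rhs eq) (rhs-node n j z))
    (π₂-pair (pair n (pair j z)) c)
    where
    eq : π₁ (pair (pair n (pair j z)) c) ≡ pair n (pair j z)
    eq = π₁-pair (pair n (pair j z)) c

  index : ℕ → ℕ
  index = specialise (Mu (compile₁ enumerateT))

  Lang-index : ∀ n j z → Lang (index n) j z ⇔ (∃ λ c → Member n (π₁ j) (π₂ j) z c)
  Lang-index n j z = ⇔-trans (specialise-W (Mu (compile₁ enumerateT)) n (pair j z))
    (⇔-trans (Mu-domain enumerateT (pair n (pair j z))) (mk⇔
      (λ (c , eq) → c , to (⟦memberT⟧ n (π₁ j) (π₂ j) z c) (trans (sym (enumerate-at n j z c)) eq))
      (λ (c , m) → c , trans (enumerate-at n j z c) (from (⟦memberT⟧ n (π₁ j) (π₂ j) z c) m))))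

  index-recursive : Recursive (λ n → triple (index n) 0 3)
  index-recursive = specialise-recursive (Mu (compile₁ enumerateT)) 0 3

  -- The index 0 unpairs to ⟨0,0⟩, whose language is ℕ.
  Lang-index-zero : ∀ n z → Lang (index n) 0 z
  Lang-index-zero n z = from (Lang-index n 0 z) (0 , tt)

  full : ∀ n y c → (∀ z → Member n (π₁ y) (π₂ y) z c) → SameSet (Lang (index n) 0) (Lang (index n) y)
  full n y c h z = mk⇔ (λ _ → from (Lang-index n y z) (c , h z)) (λ _ → Lang-index-zero n z)

  -- A language that agrees with ℕ on {0,1} contains both points. A singleton cannot, so if the
  -- index is not one of ℕ, a point is present through `Extra`, which makes the language ℕ.
  distinguishes-3 : ∀ n → DS₃ (index n) 0 3
  distinguishes-3 n y ¬same same∩ =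
    let (c , h) = all (π₁ y) (mem 0 refl) (mem 1 refl) in ¬same (full n y c h)
    where
    mem : ∀ z → z ∈D 3 → ∃ λ c → Member n (π₁ y) (π₂ y) z c
    mem z z∈ = to (Lang-index n y z) (proj₁ (to (same∩ z) (Lang-index-zero n z , z∈)))
    all : ∀ a → (∃ λ c → Member n a (π₂ y) 0 c) → (∃ λ c → Member n a (π₂ y) 1 c) →
          ∃ λ c → ∀ z → Member n a (π₂ y) z c
    all zero    m              m′              = 0 , λ _ → tt
    all (suc d) (c , inj₂ x)   m′              = c , λ _ → inj₂ x
    all (suc d) m              (c , inj₂ x)    = c , λ _ → inj₂ x
    all (suc d) (c , inj₁ refl) (c′ , inj₁ ())

  module _ (em : ExcludedMiddle 0ℓ) where
    open Classical em

    complete : ∀ n → (∀ a → ∃ λ b → ∀ c → χ (pair n (pair a (pair b c))) ≡ 0) ⇔ MDS₃ (index n) 0 3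
    complete n = mk⇔ (λ h → distinguishes-3 n , minimal h) (λ (_ , min) a → converse a
      (min (2 ^ (2 + a)) (unique⇒card<2 (2 ^ (2 + a)) (2 + a) (∈D-2^⇒≡ (2 + a)))))
      where
      -- The bound is 2 because `card 3` computes to 2. If `d` is the only possible element of D_u,
      -- then {d} and ℕ have the same trace on D_u, and `choose` finds a copy of {d} that never
      -- grows.
      minimal : (∀ a → ∃ λ b → ∀ c → χ (pair n (pair a (pair b c))) ≡ 0) →
                ∀ u → card u < 2 → ¬ DS₃ (index n) 0 u
      minimal h u lt ds = ds y ¬same same∩
        where
        d = proj₁ (card<2⇒unique u lt)
        uniq = proj₂ (card<2⇒unique u lt)
        choose : ∀ d → ∃ λ b → ∀ c → ¬ Extra n d b c
        choose 0             = 0 , λ _ ()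
        choose 1             = 0 , λ _ ()
        choose (suc (suc a)) = let (b , eq) = h a in b , λ c neq → neq (eq c)
        b = proj₁ (choose d)
        y = pair (suc d) b
        Lang-y : ∀ z → Lang (index n) y z ⇔ (∃ λ c → Member n (suc d) b z c)
        Lang-y z = subst₂ (λ a b → Lang (index n) y z ⇔ (∃ λ c → Member n a b z c))
          (π₁-pair (suc d) b) (π₂-pair (suc d) b) (Lang-index n y z)
        -- `suc d` serves as a point of ℕ outside {d}.
        absent : ¬ ∃ λ c → Member n (suc d) b (suc d) c
        absent (c , inj₁ eq) = 1+n≢n eq
        absent (c , inj₂ x)  = proj₂ (choose d) c x
        ¬same : ¬ SameSet (Lang (index n) 0) (Lang (index n) y)
        ¬same same = absent (to (Lang-y (suc d)) (to (same (suc d)) (Lang-index-zero n (suc d))))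
        same∩ : SameSet (Lang (index n) 0 ∩D u) (Lang (index n) y ∩D u)
        same∩ z = mk⇔ (λ (_ , z∈) → from (Lang-y z) (0 , inj₁ (uniq z z∈)) , z∈)
                      (λ (_ , z∈) → Lang-index-zero n z , z∈)

      -- Some member other than ℕ contains `2 + a`, so it can only be {a+2}, at an index ⟨a+3,b⟩
      -- from which the witness `b` is read off. A `c` with nonzero χ would turn this member into ℕ.
      converse : ∀ a → ¬ DS₃ (index n) 0 (2 ^ (2 + a)) →
                 ∃ λ b → ∀ c → χ (pair n (pair a (pair b c))) ≡ 0
      converse a ¬ds = b , λ c → dne λ neq → proj₂ undistinguished λ ¬same same∩ →
        ¬same (all c neq (to (Lang-index n y (2 + a))
          (proj₁ (to (same∩ (2 + a)) (Lang-index-zero n (2 + a) , ∈D-2^ (2 + a))))))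
        where
        undistinguished = ¬∀⇒∃¬ ¬ds
        y = proj₁ undistinguished
        b = π₂ y
        go : ∀ A c → χ (pair n (pair a (pair b c))) ≢ 0 → (∃ λ c → Member n A b (2 + a) c) →
             ∃ λ c → ∀ z → Member n A b z c
        go zero    c neq m               = 0 , λ _ → tt
        go (suc d) c neq (_ , inj₁ refl) = c , λ _ → inj₂ neq
        go (suc d) c neq (c′ , inj₂ x)   = c′ , λ _ → inj₂ x
        all : ∀ c → χ (pair n (pair a (pair b c))) ≢ 0 →
              (∃ λ c → Member n (π₁ y) b (2 + a) c) →
              SameSet (Lang (index n) 0) (Lang (index n) y)
        all c neq m = let (c′ , h) = go (π₁ y) c neq m in full n y c′ h

theorem2 : ExcludedMiddle 0ℓ → Π⁰₃-complete MDS
theorem2 em = MDS-Π⁰₃ , hard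
  where
  open Classical em
  MDS-triple : ∀ e x u → MDS₃ e x u ⇔ MDS (triple e x u)
  MDS-triple e x u = ⇔-sym (⇔-trans (MDS⇔MDS₃ (triple e x u))
    (subst (λ e′ → MDS₃ e′ (lhs (triple e x u)) (rhs (triple e x u)) ⇔ MDS₃ e x u)
      (sym (π₁-pair e (pair x u)))
      (subst₂ (λ x′ u′ → MDS₃ e x′ u′ ⇔ MDS₃ e x u)
        (sym (lhs-node e x u)) (sym (rhs-node e x u)) (mk⇔ (λ m → m) (λ m → m)))))
  hard : ∀ B → Π⁰₃ B → B ≤m MDS
  hard B (χ , χ-rec , B⇔) =
    (λ n → triple (index n) 0 3) , index-recursive ,
    λ n → ⇔-trans (B⇔ n) (⇔-trans (complete em n) (MDS-triple (index n) 0 3))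
    where open Reduction χ χ-rec
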